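{- For any $w\in S_n$, the staircase chain $C^S(w)$ is a heavy climbing chain of $w$.
   Context: Conventions. Permutations are in one-line notation; $t_{ij}$ is the transposition of $i,j$, and $wt_{ij}$ is $w$ with the values in positions $i$ and $j$ exchanged. $w_0\in S_n$ is the longest permutation, $w_0(k)=n+1-k$. The Bruhat order is the transitive closure of $w\le wt_{ij}$ for $i<j$ with $w(i)<w(j)$; $\lessdot$ denotes its cover relation. $[n]=\{1,\ldots,n\}$. Climbing chains. A climbing chain of $w\in S_n$ is a sequence $C=(C_1,\ldots,C_m)$ of pairs (links) $C_p=(i_p,j_p)$ with $i_p<j_p$, $i_1\le\cdots\le i_m$, $wt_{i_1j_1}\cdots t_{i_mj_m}=w_0$, and $wt_{i_1j_1}\cdots t_{i_{p-1}j_{p-1}}\lessdot wt_{i_1j_1}\cdots t_{i_pj_p}$ for each $p\in[m]$. (The only climbing chain of $w_0$ is empty.) The set of minimal markings is $M(C)=\{C_p\mid i_{p-1}<i_p,\text{ or } i_{p-1}=i_p\text{ and }j_{p-1}<j_p\}$ with $i_0=0$. Codes. $\overline{\mathrm{rajcode}}(w)_i$ is the maximal number $r$ of positions in a sequence $i=\alpha_1<\cdots<\alpha_r\le n$ with $w(\alpha_1)<\cdots<w(\alpha_r)$, minus one, and $\overline{\mathrm{raj}}(w)=\sum_i\overline{\mathrm{rajcode}}(w)_i$. A climbing chain $C$ of $w$ is heavy if $\#M(C)=\overline{\mathrm{raj}}(w)$. Staircase chain. For $w\ne w_0$ let $a=\min\{k\mid w(k)\ne n+1-k\}$ and $K=\{k\mid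 k>a\text{ and }w\lessdot wt_{ak}\}$. Let $K_1$ be the set of $k\in K$ at which $\overline{\mathrm{rajcode}}(w)_k$ attains its maximum over $K$. Iteratively, for $p\ge 2$, as long as there are elements of $K$ smaller than $\min(K_{p-1})$, let $K_p$ be the set of $k\in K$ with $k<\min(K_{p-1})$ at which $\overline{\mathrm{rajcode}}(w)_k$ attains its maximum over $\{k'\in K\mid k'<\min(K_{p-1})\}$. If this results in sets $K_1,\ldots,K_q$, then $\mathrm{stair}(w)$ is the sequence of pairs $(a,k)$, $k\in K_1\cup\cdots\cup K_q$, ordered so that the second components are decreasing. $C^S(w_0)$ is empty; for $w\neq w_0$ with $\mathrm{stair}(w)=((a,b_1),\ldots,(a,b_k))$, $C^S(w)$ is the concatenation of $\mathrm{stair}(w)$ and $C^S(wt_{ab_1}\cdots t_{ab_k})$. -}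

module Defs where

open import Data.Fin.Base using (Fin; opposite; _<_; _≤_; _>_)
open import Data.Fin.Permutation
  using (Permutation′; _⟨$⟩ʳ_; _≈_; _∘ₚ_; transpose; reverse)
open import Data.Fin.Properties using (_≟_; _<?_)
open import Data.List.Base
  using (List; []; _∷_; _++_; map; foldl; filter; deduplicate; zip; length; allFin)
open import Data.List.Extrema.Nat using (max)
open import Data.List.Membership.Propositional using (_∈_)
open import Data.List.Relation.Unary.All using (All)
open import Data.List.Relation.Unary.Linked using (Linked; linked?)
open import Data.Nat.Base as ℕ using (ℕ; zero; suc; _∸_)
open import Data.Nat.ListAction using (sum)
open import Data.Product.Base using (_×_; _,_; ∃; ∃₂; proj₁; proj₂; uncurry)
open import Data.Product.Properties using (≡-dec)
open import Data.Product.Relation.Binary.Lex.Strict using (×-Lex; ×-decidable)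
open import Function.Bundles using (_⇔_)
open import Level using (0ℓ)
open import Relation.Binary.Construct.Closure.Transitive using (TransClosure)
open import Relation.Binary.Core using (Rel)
open import Relation.Binary.Definitions using (Decidable)
open import Relation.Binary.PropositionalEquality using (_≡_; _≢_)
open import Relation.Nullary using (¬_)
open import Relation.Nullary.Decidable using (_×-dec_)
open import Relation.Unary using (Pred)

-- Positions and values are 0-based: Fin n stands for {1, …, n} shifted by one.
-- Permutations are compared by the pointwise equality _≈_, and `reverse` is the
-- longest permutation w₀.

Link : ℕ → Set
Link n = Fin n × Fin n

infixl 7 _·_ _·*_

-- w · (i , j) is w t_{ij}: _∘ₚ_ applies its left argument first, so it is the
-- values in positions i and j that are exchanged.
_·_ : ∀ {n} → Permutation′ n → Link n → Permutation′ n
w · (i , j) = transpose i j ∘ₚ w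

_·*_ : ∀ {n} → Permutation′ n → List (Link n) → Permutation′ n
w ·* C = foldl _·_ w C

------------------------------------------------------------------------
-- Bruhat order

BruhatStep : ∀ {n} → Rel (Permutation′ n) 0ℓ
BruhatStep u v = ∃₂ λ i j → i < j × u ⟨$⟩ʳ i < u ⟨$⟩ʳ j × v ≈ u · (i , j)

infix 4 _<ᴮ_ _⋖_

-- The strict part of the Bruhat order.
_<ᴮ_ : ∀ {n} → Rel (Permutation′ n) 0ℓ
_<ᴮ_ = TransClosure BruhatStep

_⋖_ : ∀ {n} → Rel (Permutation′ n) 0ℓ
u ⋖ v = u <ᴮ v × ¬ (∃ λ z → u <ᴮ z × z <ᴮ v)

------------------------------------------------------------------------
-- Codes

sublists : ∀ {A : Set} → List A → List (List A)
sublists []       = [] ∷ []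
sublists (x ∷ xs) = map (x ∷_) (sublists xs) ++ sublists xs

Ascent : ∀ {n} → Permutation′ n → Rel (Fin n) 0ℓ
Ascent w k l = k < l × w ⟨$⟩ʳ k < w ⟨$⟩ʳ l

ascent? : ∀ {n} (w : Permutation′ n) → Decidable (Ascent w)
ascent? w k l = (k <? l) ×-dec ((w ⟨$⟩ʳ k) <? (w ⟨$⟩ʳ l))

-- All sequences i = α₁ < ⋯ < α_r with w(α₁) < ⋯ < w(α_r). The codes below are the
-- overlined ones, built from increasing sequences.
increasingFrom : ∀ {n} → Permutation′ n → Fin n → List (List (Fin n))
increasingFrom {n} w i =
  filter (linked? (ascent? w)) (map (i ∷_) (sublists (allFin n)))

rajcode : ∀ {n} → Permutation′ n → Fin n → ℕ
rajcode w i = max 0 (map length (increasingFrom w i)) ∸ 1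

raj : ∀ {n} → Permutation′ n → ℕ
raj {n} w = sum (map (rajcode w) (allFin n))

------------------------------------------------------------------------
-- Climbing chains

data Covers {n} (w : Permutation′ n) : List (Link n) → Set where
  []  : Covers w []
  _∷_ : ∀ {c C} → w ⋖ w · c → Covers (w · c) C → Covers w (c ∷ C)

record IsClimbingChain {n} (w : Permutation′ n) (C : List (Link n)) : Set where
  field
    links  : All (uncurry _<_) C
    sorted : Linked (λ c d → proj₁ c ≤ proj₁ d) C
    ends   : w ·* C ≈ reverse
    covers : Covers w C

_<ₗₑₓ_ : ∀ {n} → Rel (Link n) 0ℓ
_<ₗₑₓ_ = ×-Lex _≡_ _<_ _<_

_<ₗₑₓ?_ : ∀ {n} → Decidable (_<ₗₑₓ_ {n})
_<ₗₑₓ?_ = ×-decidable _≟_ _<?_ _<?_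

-- M(C). A first link is always marked, because of the convention i₀ = 0; a later
-- one is marked when it is lexicographically larger than its predecessor.
minimalMarkings : ∀ {n} → List (Link n) → List (Link n)
minimalMarkings []      = []
minimalMarkings (c ∷ C) =
  c ∷ map proj₂ (filter (λ p → proj₁ p <ₗₑₓ? proj₂ p) (zip (c ∷ C) C))

-- M(C) is a set of links, hence the removal of repetitions.
#M : ∀ {n} → List (Link n) → ℕ
#M C = length (deduplicate (≡-dec _≟_ _≟_) (minimalMarkings C))

record IsHeavyClimbingChain {n} (w : Permutation′ n) (C : List (Link n)) : Set where
  field
    climbing : IsClimbingChain w C
    heavy    : #M C ≡ raj w

------------------------------------------------------------------------
-- The staircase chain

IsMin : ∀ {n} → Pred (Fin n) 0ℓ → Pred (Fin n) 0ℓ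
IsMin S m = S m × (∀ {k} → S k → m ≤ k)

ArgMax : ∀ {n} → (Fin n → ℕ) → Pred (Fin n) 0ℓ → Pred (Fin n) 0ℓ
ArgMax f S k = S k × (∀ {l} → S l → f l ℕ.≤ f k)

K : ∀ {n} → Permutation′ n → Fin n → Pred (Fin n) 0ℓ
K w a k = a < k × w ⋖ w · (a , k)

-- Layer w a p is K_{p+1}. Once a layer is empty it has no minimum, so all
-- subsequent layers are empty too.
Layer : ∀ {n} → Permutation′ n → Fin n → ℕ → Pred (Fin n) 0ℓ
Layer w a zero    = ArgMax (rajcode w) (K w a)
Layer w a (suc p) = ArgMax (rajcode w)
  (λ k → K w a k × ∃ λ m → IsMin (Layer w a p) m × k < m)

-- stair(w) is the list of the (a , b) for b in bs.
record IsStair {n} (w : Permutation′ n) (a : Fin n) (bs : List (Fin n)) : Set where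
  field
    first      : IsMin (λ k → w ⟨$⟩ʳ k ≢ opposite k) a
    decreasing : Linked _>_ bs
    members    : ∀ k → k ∈ bs ⇔ ∃ λ p → Layer w a p k

-- The graph of w ↦ C^S(w). Membership in K is not decided by definition, so the
-- recursion is given as a relation; that it is total and single-valued is a
-- theorem.
data IsStaircaseChain {n} (w : Permutation′ n) : List (Link n) → Set where
  done : w ≈ reverse → IsStaircaseChain w []
  step : ∀ {a bs C} → ¬ (w ≈ reverse) → IsStair w a bs →
         IsStaircaseChain (w ·* map (a ,_) bs) C →
         IsStaircaseChain w (map (a ,_) bs ++ C)

{-# OPTIONS --safe #-}

-- K_1 ∪ ⋯ ∪ K_q consists of the weak left-to-right records of the code r on K.
-- Swap along these records b_1 > ⋯ > b_k, with a, and let every value carry its r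
-- with it, except that w(a) first loses one. Because the b_j are records, the
-- result satisfies the recursion r(i) = max {r(l) + 1 | i < l, w(i) < w(l)} that
-- characterizes the code, so a stair lowers raj by exactly 1. On the other hand
-- the second components decrease within a stair, while all ascents from a that are
-- left after it lie to the right of its last link, so exactly the first link of
-- each stair is marked. Hence #M is the number of stairs, which is raj.
module Submission where

open import Defs
import Algebra.Properties.CommutativeMonoid.Sum as Sum
open import Data.Empty using (⊥-elim)
open import Data.Fin.Base using (Fin; opposite; punchIn; punchOut; toℕ; _<_; _≤_; _>_)
import Data.Fin.Induction as Fin
open import Data.Fin.Permutation
  using (Permutation′; _⟨$⟩ʳ_; _⟨$⟩ˡ_; _≈_; transpose; reverse; inverseʳ)
import Data.Fin.Permutation.Components as PC
open import Data.Fin.Properties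
  using (_≟_; _<?_; <⇒≢; ≤∧≢⇒<; any?; all?; toℕ<n; toℕ-injective; opposite-prop; opposite-involutive;
         punchInᵢ≢i; punchIn-punchOut; punchIn-injective)
open import Data.List.Base
  using (List; []; _∷_; _++_; map; foldl; filter; deduplicate; zip; length; allFin; tabulate)
open import Data.List.Extrema.Nat using (max; xs≤max; argmax; argmax-sel; argmax-all; f[xs]≤f[argmax])
open import Data.List.Membership.Propositional using (_∈_; _∉_)
open import Data.List.Membership.Propositional.Properties
  using (∈-map⁺; ∈-map⁻; ∈-filter⁺; ∈-filter⁻; ∈-++⁺ˡ; ∈-++⁺ʳ; ∈-allFin; ∈-tabulate⁺)
open import Data.List.Properties using (map-tabulate; foldl-++; filter-all; filter-accept; filter-reject)
open import Data.List.Relation.Binary.Sublist.Propositional using (_⊆_; []; _∷_; _∷ʳ_)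
import Data.List.Relation.Binary.Sublist.Propositional.Properties as Sublist
open import Data.List.Relation.Unary.All as All using (All; []; _∷_)
import Data.List.Relation.Unary.All.Properties as All
open import Data.List.Relation.Unary.AllPairs as AllPairs using (AllPairs; []; _∷_)
import Data.List.Relation.Unary.AllPairs.Properties as AllPairs
open import Data.List.Relation.Unary.Any using (here; there)
open import Data.List.Relation.Unary.Linked as Linked using (Linked; []; [-]; _∷_; linked?)
import Data.List.Relation.Unary.Linked.Properties as Linked
open import Data.List.Relation.Unary.Unique.Propositional using (Unique)
open import Data.Nat.Base as ℕ using (ℕ; zero; suc; pred; _+_; _∸_; z≤n; s≤s)
import Data.Nat.ListAction as ℕ
import Data.Nat.Properties as ℕ
open import Data.Product using (_×_; _,_; ∃; ∃!; proj₁; proj₂; uncurry)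
open import Data.Product.Properties using (≡-dec)
open import Data.Sum.Base using (_⊎_; inj₁; inj₂; [_,_]′)
open import Data.Vec.Functional using (removeAt; updateAt)
open import Data.Vec.Functional.Properties using (updateAt-updates; updateAt-minimal)
open import Function.Base using (_∘_; id)
open import Function.Bundles using (_⇔_; mk⇔; Equivalence; Injection)
open import Function.Construct.Composition using (_⇔-∘_)
open import Function.Construct.Symmetry using (⇔-sym)
open import Function.Properties.Inverse using (↔⇒↣)
open import Induction.WellFounded using (Acc; acc)
open import Level using (0ℓ)
open import Relation.Binary.Construct.Closure.Transitive using ([_]; _∷_)
open import Relation.Binary.PropositionalEquality
  using (_≡_; _≢_; refl; sym; trans; cong; cong₂; subst; subst₂; ≢-sym)
open import Relation.Nullary using (¬_; Dec; yes; no; contradiction)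
open import Relation.Nullary.Decidable using (_×-dec_; _→-dec_; ¬?; map′; decidable-stable)
open import Relation.Unary using (Pred; Decidable)

open Sum ℕ.+-0-commutativeMonoid
  using (sum-cong-≗; sum-permute; sum-remove; sum-replicate-zero; ∑-distrib-+)
  renaming (sum to ∑)

-- The loss of one at w(a) originates in the first link b: the code at `a` is one more than the
-- largest code on K, and b attains that largest code. So the lowered code of w(a) equals the code
-- at b, where w(a) settles. Between two swaps of a stair the carried function need not satisfy the
-- recursion at `a`; the invariant therefore records at `a` only what the later swaps draw on.
-- Covers are defined by the absence of intermediate elements; counting inversions turns this into
-- the emptiness of a rectangle, a decidable condition on which the rest runs. M(C) is a set, so the
-- count also requires that a climbing chain repeats no link. The drop of raj by exactly 1 serves
-- twice: for the count, and as the measure that makes the staircase recursion terminate.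

private variable
  n : ℕ

-- Finite sums

∑-mono : {f g : Fin n → ℕ} → (∀ i → f i ℕ.≤ g i) → ∑ f ℕ.≤ ∑ g
∑-mono {zero}  f≤g = z≤n
∑-mono {suc n} f≤g = ℕ.+-mono-≤ (f≤g Fin.zero) (∑-mono (f≤g ∘ Fin.suc))

-- The index `i` may break monotonicity. The offsets give strictness with `c = 1`, `d = 0`, and an
-- excess of at most one with `c = 0`, `d = 1`.
∑-mono-except : ∀ {f g : Fin n → ℕ} (i : Fin n) (c d : ℕ) →
  (∀ j → j ≢ i → f j ℕ.≤ g j) → c + f i ℕ.≤ d + g i → c + ∑ f ℕ.≤ d + ∑ g
∑-mono-except {suc n} {f} {g} i c d f≤g at-i = begin
  c + ∑ f                        ≡⟨ cong (c +_) (sum-remove f) ⟩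
  c + (f i + ∑ (removeAt f i))   ≡⟨ ℕ.+-assoc c _ _ ⟨
  c + f i + ∑ (removeAt f i)     ≤⟨ ℕ.+-mono-≤ at-i (∑-mono λ j → f≤g _ (punchInᵢ≢i i j)) ⟩
  d + g i + ∑ (removeAt g i)     ≡⟨ ℕ.+-assoc d _ _ ⟩
  d + (g i + ∑ (removeAt g i))   ≡⟨ cong (d +_) (sum-remove g) ⟨
  d + ∑ g                        ∎
  where open ℕ.≤-Reasoning

∑-mono-except₂ : ∀ {f g : Fin n → ℕ} {i k : Fin n} → i ≢ k → ∀ (c d : ℕ) →
  (∀ j → j ≢ i → j ≢ k → f j ℕ.≤ g j) →
  c + (f i + f k) ℕ.≤ d + (g i + g k) → c + ∑ f ℕ.≤ d + ∑ g
∑-mono-except₂ {suc n} {f} {g} {i} {k} i≢k c d f≤g at-ik = begin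
  c + ∑ f                        ≡⟨ cong (c +_) (sum-remove f) ⟩
  c + (f i + ∑ (removeAt f i))   ≡⟨ ℕ.+-assoc c _ _ ⟨
  c + f i + ∑ (removeAt f i)     ≤⟨ ∑-mono-except (punchOut i≢k) (c + f i) (d + g i)
                                      (λ j j≢ → f≤g _ (punchInᵢ≢i i j)
                                        λ e → j≢ (punchIn-injective i _ _ (trans e (sym k≡))))
                                      at-k ⟩
  d + g i + ∑ (removeAt g i)     ≡⟨ ℕ.+-assoc d _ _ ⟩
  d + (g i + ∑ (removeAt g i))   ≡⟨ cong (d +_) (sum-remove g) ⟨
  d + ∑ g                        ∎
  where
  open ℕ.≤-Reasoning
  k≡ : punchIn i (punchOut i≢k) ≡ k
  k≡ = punchIn-punchOut i≢k
  at-k : c + f i + f (punchIn i (punchOut i≢k)) ℕ.≤ d + g i + g (punchIn i (punchOut i≢k))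
  at-k rewrite k≡ | ℕ.+-assoc c (f i) (f k) | ℕ.+-assoc d (g i) (g k) = at-ik

𝟙 : ∀ {P : Set} → Dec P → ℕ
𝟙 (yes _) = 1
𝟙 (no _)  = 0

𝟙-mono : ∀ {P Q : Set} (P? : Dec P) (Q? : Dec Q) → (P → Q) → 𝟙 P? ℕ.≤ 𝟙 Q?
𝟙-mono (no _)  _        _   = z≤n
𝟙-mono (yes p) (yes _)  _   = ℕ.≤-refl
𝟙-mono (yes p) (no ¬q)  p→q = contradiction (p→q p) ¬q

𝟙≤1 : ∀ {P : Set} (P? : Dec P) → 𝟙 P? ℕ.≤ 1
𝟙≤1 (yes _) = ℕ.≤-refl
𝟙≤1 (no _)  = z≤n

𝟙-no : ∀ {P : Set} (P? : Dec P) → ¬ P → 𝟙 P? ≡ 0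
𝟙-no (yes p) ¬p = contradiction p ¬p
𝟙-no (no _)  _  = refl

𝟙-yes : ∀ {P : Set} (P? : Dec P) → P → 𝟙 P? ≡ 1
𝟙-yes (yes _) _ = refl
𝟙-yes (no ¬p) p = contradiction p ¬p

-- Transpositions

transpose-left : ∀ (i j : Fin n) → PC.transpose i j i ≡ j
transpose-left i j with i ≟ i
... | yes _  = refl
... | no i≢i = contradiction refl i≢i

transpose-right : ∀ (i j : Fin n) → PC.transpose i j j ≡ i
transpose-right i j with j ≟ i
... | yes j≡i = j≡i
... | no _ with j ≟ j
...   | yes _  = refl
...   | no j≢j = contradiction refl j≢j

transpose-other : ∀ {i j k : Fin n} → k ≢ i → k ≢ j → PC.transpose i j k ≡ k
transpose-other {i = i} {j} {k} k≢i k≢j with k ≟ i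
... | yes k≡i = contradiction k≡i k≢i
... | no _ with k ≟ j
...   | yes k≡j = contradiction k≡j k≢j
...   | no _    = refl

data TransposeView (i j : Fin n) (k : Fin n) : Set where
  left  : k ≡ i → PC.transpose i j k ≡ j → TransposeView i j k
  right : k ≡ j → PC.transpose i j k ≡ i → TransposeView i j k
  other : k ≢ i → k ≢ j → PC.transpose i j k ≡ k → TransposeView i j k

transpose-view : ∀ (i j k : Fin n) → TransposeView i j k
transpose-view i j k with k ≟ i | k ≟ j
... | yes refl | _        = left refl (transpose-left i j)
... | no _     | yes refl = right refl (transpose-right i j)
... | no k≢i   | no k≢j   = other k≢i k≢j (transpose-other k≢i k≢j)

transpose-involutive : ∀ (i j k : Fin n) → PC.transpose i j (PC.transpose i j k) ≡ k
transpose-involutive i j k with transpose-view i j k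
... | left refl e  = trans (cong (PC.transpose i j) e) (transpose-right i j)
... | right refl e = trans (cong (PC.transpose i j) e) (transpose-left i j)
... | other _ _ e  = trans (cong (PC.transpose i j) e) e

⟨$⟩ʳ-injective : ∀ (w : Permutation′ n) {i j} → w ⟨$⟩ʳ i ≡ w ⟨$⟩ʳ j → i ≡ j
⟨$⟩ʳ-injective w = Injection.injective (↔⇒↣ w)

≮∧≢⇒> : ∀ {i j : Fin n} → ¬ i < j → i ≢ j → j < i
≮∧≢⇒> i≮j i≢j = ≤∧≢⇒< (ℕ.≮⇒≥ i≮j) (≢-sym i≢j)

-- Inversions

inversion? : ∀ (w : Permutation′ n) i j → Dec (i < j × w ⟨$⟩ʳ j < w ⟨$⟩ʳ i)
inversion? w i j = (i <? j) ×-dec ((w ⟨$⟩ʳ j) <? (w ⟨$⟩ʳ i))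

inversionsAt : Permutation′ n → Fin n → ℕ
inversionsAt w i = ∑ λ j → 𝟙 (inversion? w i j)

inversions : Permutation′ n → ℕ
inversions w = ∑ (inversionsAt w)

-- K with the cover relation made explicit; see K°⇒⋖ and ⋖⇒K°.
K° : Permutation′ n → Fin n → Fin n → Set
K° w a k = Ascent w a k ×
  (∀ l → a < l → l < k → w ⟨$⟩ʳ a < w ⟨$⟩ʳ l → ¬ w ⟨$⟩ʳ l < w ⟨$⟩ʳ k)

module _ (w : Permutation′ n) {a k : Fin n} (a<k : a < k) where
  private
    w′ = w · (a , k)
    t  = PC.transpose a k

    w′a : w′ ⟨$⟩ʳ a ≡ w ⟨$⟩ʳ k
    w′a = cong (w ⟨$⟩ʳ_) (transpose-left a k)

    w′k : w′ ⟨$⟩ʳ k ≡ w ⟨$⟩ʳ a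
    w′k = cong (w ⟨$⟩ʳ_) (transpose-right a k)

    w′-other : ∀ {j} → j ≢ a → j ≢ k → w′ ⟨$⟩ʳ j ≡ w ⟨$⟩ʳ j
    w′-other j≢a j≢k = cong (w ⟨$⟩ʳ_) (transpose-other j≢a j≢k)

    t-preserves : ∀ {i} → i ≢ a → i ≢ k → ¬ (a < i × i < k) → ∀ {j} → i < j → i < t j
    t-preserves {i} i≢a i≢k outside {j} i<j with transpose-view a k j
    ... | left refl e rewrite e = ℕ.<-trans i<j a<k
    ... | other _ _ e rewrite e = i<j
    ... | right refl e rewrite e with i <? a
    ...   | yes i<a = i<a
    ...   | no i≮a  = contradiction (≮∧≢⇒> i≮a i≢a , i<j) outside

    inversionsAt-outside : ∀ {i} → i ≢ a → i ≢ k → ¬ (a < i × i < k) →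
      inversionsAt w′ i ≡ inversionsAt w i
    inversionsAt-outside {i} i≢a i≢k outside = trans
      (sum-cong-≗ λ j → ℕ.≤-antisym
        (𝟙-mono (inversion? w′ i j) (inversion? w i (t j)) λ (i<j , lt) →
          t-preserves i≢a i≢k outside i<j , subst (w′ ⟨$⟩ʳ j <_) (w′-other i≢a i≢k) lt)
        (𝟙-mono (inversion? w i (t j)) (inversion? w′ i j) λ (i<tj , lt) →
          subst (i <_) (transpose-involutive a k j) (t-preserves i≢a i≢k outside i<tj)
          , subst (w′ ⟨$⟩ʳ j <_) (sym (w′-other i≢a i≢k)) lt))
      (sym (sum-permute (λ j → 𝟙 (inversion? w i j)) (transpose a k)))

    -- In a column right of `k` the swap exchanges the entries of rows `a` and `k`, so these rows
    -- are compared column by column after being added.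
    pairRow : Permutation′ n → Fin n → ℕ
    pairRow v j = 𝟙 (inversion? v a j) + 𝟙 (inversion? v k j)

    pairRow-left : ∀ v → pairRow v a ≡ 0
    pairRow-left v = cong₂ _+_
      (𝟙-no (inversion? v a a) λ (a<a , _) → ℕ.<-irrefl refl a<a)
      (𝟙-no (inversion? v k a) λ (k<a , _) → ℕ.<-asym k<a a<k)

    pairRow-right : ∀ v → 𝟙 (inversion? v k k) ≡ 0
    pairRow-right v = 𝟙-no (inversion? v k k) λ (k<k , _) → ℕ.<-irrefl refl k<k

    pairRow-beyond : ∀ {j} → k < j → pairRow w j ≡ pairRow w′ j
    pairRow-beyond {j} k<j = trans (ℕ.+-comm (𝟙 (inversion? w a j)) _) (cong₂ _+_
      (ℕ.≤-antisym
        (𝟙-mono (inversion? w k j) (inversion? w′ a j) λ (_ , lt) → a<j , subst₂ _<_ (sym w′j) (sym w′a) lt)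
        (𝟙-mono (inversion? w′ a j) (inversion? w k j) λ (_ , lt) → k<j , subst₂ _<_ w′j w′a lt))
      (ℕ.≤-antisym
        (𝟙-mono (inversion? w a j) (inversion? w′ k j) λ (_ , lt) → k<j , subst₂ _<_ (sym w′j) (sym w′k) lt)
        (𝟙-mono (inversion? w′ k j) (inversion? w a j) λ (_ , lt) → a<j , subst₂ _<_ w′j w′k lt)))
      where
      a<j = ℕ.<-trans a<k k<j
      w′j = w′-other (≢-sym (<⇒≢ a<j)) (≢-sym (<⇒≢ k<j))

    pairRow-before : ∀ v {j} → ¬ k < j → 𝟙 (inversion? v k j) ≡ 0
    pairRow-before v {j} k≮j = 𝟙-no (inversion? v k j) (k≮j ∘ proj₁)

    rows-ak : ∀ v → inversionsAt v a + inversionsAt v k ≡ ∑ (pairRow v)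
    rows-ak v = sym (∑-distrib-+ (λ j → 𝟙 (inversion? v a j)) (λ j → 𝟙 (inversion? v k j)))

  -- Rows strictly between `a` and `k` never lose, rows outside are permuted, and rows `a` and `k`
  -- together gain the inversion (a, k) in column `k`.
  inversions-increase : w ⟨$⟩ʳ a < w ⟨$⟩ʳ k → inversions w ℕ.< inversions w′
  inversions-increase wa<wk = ∑-mono-except₂ (<⇒≢ a<k) 1 0 others
    (subst₂ ℕ._≤_ (cong suc (sym (rows-ak w))) (sym (rows-ak w′))
      (∑-mono-except k 1 0 pair pair-k))
    where
    others : ∀ i → i ≢ a → i ≢ k → inversionsAt w i ℕ.≤ inversionsAt w′ i
    others i i≢a i≢k with (a <? i) ×-dec (i <? k)
    ... | no outside = ℕ.≤-reflexive (sym (inversionsAt-outside i≢a i≢k outside))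
    ... | yes (a<i , i<k) = ∑-mono λ j → 𝟙-mono (inversion? w i j) (inversion? w′ i j) (go j)
      where
      go : ∀ j → i < j × w ⟨$⟩ʳ j < w ⟨$⟩ʳ i → i < j × w′ ⟨$⟩ʳ j < w′ ⟨$⟩ʳ i
      go j (i<j , lt) rewrite w′-other i≢a i≢k with transpose-view a k j
      ... | left refl _ = contradiction i<j (ℕ.<-asym a<i)
      ... | right refl e rewrite e = i<j , ℕ.<-trans wa<wk lt
      ... | other _ _ e rewrite e = i<j , lt
    pair : ∀ j → j ≢ k → pairRow w j ℕ.≤ pairRow w′ j
    pair j j≢k = go (j ≟ a) (k <? j)
      where
      go : Dec (j ≡ a) → Dec (k < j) → _
      go (yes refl) _ = ℕ.≤-trans (ℕ.≤-reflexive (pairRow-left w)) z≤n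
      go (no _) (yes k<j) = ℕ.≤-reflexive (pairRow-beyond k<j)
      go (no j≢a) (no k≮j) = ℕ.+-mono-≤
        (𝟙-mono (inversion? w a j) (inversion? w′ a j) λ (a<j , lt) →
          a<j , subst₂ _<_ (sym (w′-other j≢a j≢k)) (sym w′a) (ℕ.<-trans lt wa<wk))
        (ℕ.≤-trans (ℕ.≤-reflexive (pairRow-before w k≮j)) z≤n)
    pair-k : 1 + pairRow w k ℕ.≤ pairRow w′ k
    pair-k rewrite pairRow-right w
      | 𝟙-no (inversion? w a k) (λ (_ , lt) → ℕ.<-asym lt wa<wk)
      | 𝟙-yes (inversion? w′ a k) (a<k , subst₂ _<_ (sym w′k) (sym w′a) wa<wk) = s≤s z≤n

  -- Any gain beyond the inversion (a, k) would require a position strictly between `a` and `k` with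
  -- a value strictly between w(a) and w(k).
  inversions-K° : K° w a k → inversions w′ ℕ.≤ suc (inversions w)
  inversions-K° ((_ , wa<wk) , empty) = ∑-mono-except₂ (<⇒≢ a<k) 0 1 others
    (subst₂ ℕ._≤_ (sym (rows-ak w′)) (cong suc (sym (rows-ak w)))
      (∑-mono-except k 0 1 pair pair-k))
    where
    others : ∀ i → i ≢ a → i ≢ k → inversionsAt w′ i ℕ.≤ inversionsAt w i
    others i i≢a i≢k with (a <? i) ×-dec (i <? k)
    ... | no outside = ℕ.≤-reflexive (inversionsAt-outside i≢a i≢k outside)
    ... | yes (a<i , i<k) = ∑-mono λ j → 𝟙-mono (inversion? w′ i j) (inversion? w i j) (go j)
      where
      go : ∀ j → i < j × w′ ⟨$⟩ʳ j < w′ ⟨$⟩ʳ i → i < j × w ⟨$⟩ʳ j < w ⟨$⟩ʳ i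
      go j (i<j , lt) rewrite w′-other i≢a i≢k with transpose-view a k j
      ... | left refl _ = contradiction i<j (ℕ.<-asym a<i)
      ... | right refl e rewrite e = i<j ,
        ≮∧≢⇒> (empty i a<i i<k lt) (i≢k ∘ ⟨$⟩ʳ-injective w)
      ... | other _ _ e rewrite e = i<j , lt
    pair : ∀ j → j ≢ k → pairRow w′ j ℕ.≤ pairRow w j
    pair j j≢k = go (j ≟ a) (k <? j)
      where
      go : Dec (j ≡ a) → Dec (k < j) → _
      go (yes refl) _ = ℕ.≤-trans (ℕ.≤-reflexive (pairRow-left w′)) z≤n
      go (no _) (yes k<j) = ℕ.≤-reflexive (sym (pairRow-beyond k<j))
      go (no j≢a) (no k≮j) = ℕ.+-mono-≤
        (𝟙-mono (inversion? w′ a j) (inversion? w a j) λ (a<j , lt) → a<j ,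
          ≮∧≢⇒> (λ wa<wj → empty j a<j (≮∧≢⇒> k≮j (≢-sym j≢k)) wa<wj
                   (subst₂ _<_ (w′-other j≢a j≢k) w′a lt))
                 (≢-sym j≢a ∘ ⟨$⟩ʳ-injective w))
        (ℕ.≤-trans (ℕ.≤-reflexive (pairRow-before w′ k≮j)) z≤n)
    pair-k : pairRow w′ k ℕ.≤ 1 + pairRow w k
    pair-k rewrite pairRow-right w′ | ℕ.+-identityʳ (𝟙 (inversion? w′ a k)) =
      ℕ.≤-trans (𝟙≤1 (inversion? w′ a k)) (s≤s z≤n)

inversions-cong : ∀ {v w : Permutation′ n} → v ≈ w → inversions v ≡ inversions w
inversions-cong {v = v} {w} v≈w = sum-cong-≗ λ i → sum-cong-≗ λ j → ℕ.≤-antisym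
  (𝟙-mono (inversion? v i j) (inversion? w i j) λ (i<j , lt) → i<j , subst₂ _<_ (v≈w j) (v≈w i) lt)
  (𝟙-mono (inversion? w i j) (inversion? v i j) λ (i<j , lt) → i<j , subst₂ _<_ (sym (v≈w j)) (sym (v≈w i)) lt)

-- Covers of the Bruhat order

step⇒inversions< : ∀ {u v : Permutation′ n} → BruhatStep u v → inversions u ℕ.< inversions v
step⇒inversions< {u = u} {v} (i , j , i<j , lt , v≈) =
  subst (inversions u ℕ.<_) (sym (inversions-cong {v = v} {w = u · (i , j)} v≈)) (inversions-increase u i<j lt)

<ᴮ⇒inversions< : ∀ {u v : Permutation′ n} → u <ᴮ v → inversions u ℕ.< inversions v
<ᴮ⇒inversions< {u = u} {v} [ s ] = step⇒inversions< {u = u} {v} s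
<ᴮ⇒inversions< {u = u} {v} (_∷_ {y = x} s p) =
  ℕ.<-trans (step⇒inversions< {u = u} {x} s) (<ᴮ⇒inversions< p)

-- An intermediate element would force a gain of two inversions, while an empty rectangle allows
-- only one.
K°⇒⋖ : ∀ {w : Permutation′ n} {a k} → K° w a k → w ⋖ w · (a , k)
K°⇒⋖ {w = w} {a} {k} κ@((a<k , wa<wk) , _) =
  [ (a , k , a<k , wa<wk , λ _ → refl) ] ,
  λ (z , w<z , z<w′) → ℕ.<-irrefl refl
    (ℕ.<-≤-trans (ℕ.≤-<-trans (<ᴮ⇒inversions< w<z) (<ᴮ⇒inversions< z<w′)) (inversions-K° w a<k κ))

⋖⇒K° : ∀ {w : Permutation′ n} {a k} → a < k → w ⋖ w · (a , k) → K° w a k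
⋖⇒K° {w = w} {a} {k} a<k (w<w′ , none) = (a<k , wa<wk) , empty
  where
  wa<wk : w ⟨$⟩ʳ a < w ⟨$⟩ʳ k
  -- If w(k) < w(a), swapping back is a Bruhat step, and the number of inversions would both rise
  -- and fall.
  wa<wk = ≮∧≢⇒> (λ wk<wa → ℕ.<-asym (<ᴮ⇒inversions< w<w′)
      (step⇒inversions< {u = w · (a , k)} {v = w} (a , k , a<k ,
        subst₂ _<_ (sym (cong (w ⟨$⟩ʳ_) (transpose-left a k)))
                   (sym (cong (w ⟨$⟩ʳ_) (transpose-right a k))) wk<wa ,
        λ i → cong (w ⟨$⟩ʳ_) (sym (transpose-involutive a k i)))))
    (≢-sym (<⇒≢ a<k) ∘ ⟨$⟩ʳ-injective w)
  -- With values x < y < z in positions a, l, k: (x,y,z) → (y,x,z) → (z,x,y) → (z,y,x).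
  empty : ∀ l → a < l → l < k → w ⟨$⟩ʳ a < w ⟨$⟩ʳ l → ¬ w ⟨$⟩ʳ l < w ⟨$⟩ʳ k
  empty l a<l l<k wa<wl wl<wk = none (w₁ , [ step₁ ] , _∷_ {y = w₂} step₂ [ step₃ ])
    where
    w₁ = w · (a , l)
    w₂ = w₁ · (a , k)
    a≢l = <⇒≢ a<l
    l≢k = <⇒≢ l<k
    a≢k = <⇒≢ a<k
    w₁a : w₁ ⟨$⟩ʳ a ≡ w ⟨$⟩ʳ l
    w₁a = cong (w ⟨$⟩ʳ_) (transpose-left a l)
    w₁l : w₁ ⟨$⟩ʳ l ≡ w ⟨$⟩ʳ a
    w₁l = cong (w ⟨$⟩ʳ_) (transpose-right a l)
    w₁k : w₁ ⟨$⟩ʳ k ≡ w ⟨$⟩ʳ k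
    w₁k = cong (w ⟨$⟩ʳ_) (transpose-other (≢-sym a≢k) (≢-sym l≢k))
    w₂a : w₂ ⟨$⟩ʳ a ≡ w ⟨$⟩ʳ k
    w₂a = trans (cong (w₁ ⟨$⟩ʳ_) (transpose-left a k)) w₁k
    w₂l : w₂ ⟨$⟩ʳ l ≡ w ⟨$⟩ʳ a
    w₂l = trans (cong (w₁ ⟨$⟩ʳ_) (transpose-other (≢-sym a≢l) l≢k)) w₁l
    w₂k : w₂ ⟨$⟩ʳ k ≡ w ⟨$⟩ʳ l
    w₂k = trans (cong (w₁ ⟨$⟩ʳ_) (transpose-right a k)) w₁a
    step₁ : BruhatStep w w₁
    step₁ = a , l , a<l , wa<wl , λ _ → refl
    step₂ : BruhatStep w₁ w₂
    step₂ = a , k , a<k , subst₂ _<_ (sym w₁a) (sym w₁k) wl<wk , λ _ → refl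
    step₃ : BruhatStep w₂ (w · (a , k))
    step₃ = l , k , l<k , subst₂ _<_ (sym w₂l) (sym w₂k) wa<wl , eq
      where
      eq : (w · (a , k)) ≈ (w₂ · (l , k))
      eq i = go (i ≟ a) (i ≟ l) (i ≟ k)
        where
        go : Dec (i ≡ a) → Dec (i ≡ l) → Dec (i ≡ k) → _
        go (yes refl) _ _ = trans (cong (w ⟨$⟩ʳ_) (transpose-left a k))
              (sym (trans (cong (w₂ ⟨$⟩ʳ_) (transpose-other a≢l a≢k)) w₂a))
        go (no _) (yes refl) _ = trans (cong (w ⟨$⟩ʳ_) (transpose-other (≢-sym a≢l) l≢k))
              (sym (trans (cong (w₂ ⟨$⟩ʳ_) (transpose-left l k)) w₂k))
        go (no _) (no _) (yes refl) = trans (cong (w ⟨$⟩ʳ_) (transpose-right a k))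
              (sym (trans (cong (w₂ ⟨$⟩ʳ_) (transpose-right l k)) w₂l))
        go (no i≢a) (no i≢l) (no i≢k) = cong (w ⟨$⟩ʳ_) (trans (transpose-other i≢a i≢k)
              (sym (trans (cong (PC.transpose a l) (trans (cong (PC.transpose a k) (transpose-other i≢l i≢k))
                (transpose-other i≢a i≢k))) (transpose-other i≢a i≢l))))

-- Codes

sum-allFin : ∀ (f : Fin n → ℕ) → ℕ.sum (map f (allFin n)) ≡ ∑ f
sum-allFin f = trans (cong ℕ.sum (map-tabulate id f)) (go f)
  where
  go : ∀ {n} (f : Fin n → ℕ) → ℕ.sum (tabulate f) ≡ ∑ f
  go {zero}  f = refl
  go {suc n} f = cong (f Fin.zero +_) (go (f ∘ Fin.suc))

-- For strictly increasing lists, membership of the entries already forces a sublist. This puts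
-- every increasing sequence into the enumeration behind `rajcode`.
∈-sublists : ∀ {xs ys : List (Fin n)} → AllPairs _<_ xs → AllPairs _<_ ys →
  All (_∈ ys) xs → xs ∈ sublists ys
∈-sublists {ys = []}     []             _              _        = here refl
∈-sublists {ys = []}     (_ ∷ _)        _              (() ∷ _)
∈-sublists {ys = y ∷ ys} []             (_ ∷ ys↑)      _        =
  ∈-++⁺ʳ (map (y ∷_) (sublists ys)) (∈-sublists [] ys↑ [])
∈-sublists {ys = y ∷ ys} (x<xs ∷ xs↑)   (y<ys ∷ ys↑)   (x∈ ∷ xs∈) with x∈
... | here refl = ∈-++⁺ˡ (∈-map⁺ (y ∷_) (∈-sublists xs↑ ys↑ (All.zipWith drop (x<xs , xs∈))))
  where
  drop : ∀ {z} → y < z × z ∈ y ∷ ys → z ∈ ys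
  drop (y<z , here refl)  = contradiction refl (<⇒≢ y<z)
  drop (_   , there z∈ys) = z∈ys
... | there x∈ys = ∈-++⁺ʳ (map (y ∷_) (sublists ys))
  (∈-sublists (x<xs ∷ xs↑) ys↑ (x∈ys ∷ All.zipWith drop (x<xs , xs∈)))
  where
  drop : ∀ {z} → _ < z × z ∈ y ∷ ys → z ∈ ys
  drop (x<z , here refl)  = contradiction (All.lookup y<ys x∈ys) (ℕ.<-asym x<z)
  drop (_   , there z∈ys) = z∈ys

allFin-increasing : ∀ n → AllPairs _<_ (allFin n)
allFin-increasing n = AllPairs.tabulate⁺-< id

chain-length : ∀ (w : Permutation′ n) {i xs} → Linked (Ascent w) (i ∷ xs) →
  length xs ℕ.≤ rajcode w i
chain-length w {i} {xs} chain = ℕ.∸-monoˡ-≤ 1 (All.lookup (xs≤max 0 _) (∈-map⁺ length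
  (∈-filter⁺ (linked? (ascent? w)) (∈-map⁺ (i ∷_) xs∈) chain)))
  where
  xs∈ : xs ∈ sublists (allFin _)
  xs∈ = ∈-sublists (Linked.Linked⇒AllPairs ℕ.<-trans (Linked.tail (Linked.map proj₁ chain)))
    (allFin-increasing _) (All.universal ∈-allFin xs)

longest-chain : ∀ (w : Permutation′ n) i →
  ∃ λ xs → Linked (Ascent w) (i ∷ xs) × length xs ≡ rajcode w i
longest-chain w i with argmax-sel id 0 (map length (increasingFrom w i))
-- The default `0` of `max` truncates to code `0` as well, which the chain consisting of `i` alone
-- realizes.
... | inj₁ max≡0 = [] , [-] , cong (_∸ 1) (sym max≡0)
... | inj₂ max∈ with ∈-map⁻ length max∈
...   | zs , zs∈ , max≡ with ∈-filter⁻ (linked? (ascent? w)) {xs = map (i ∷_) (sublists (allFin _))} zs∈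
...     | zs∈map , chain with ∈-map⁻ (i ∷_) zs∈map
...       | xs , _ , refl = xs , chain , cong (_∸ 1) (sym max≡)

-- The recursion for the code, its maximum split into bound and attainment, with 0 for the empty
-- maximum. It is stated at one position because it may fail at `a` during a stair.
RankAt : Permutation′ n → (Fin n → ℕ) → Fin n → Set
RankAt w f i = (∀ {l} → Ascent w i l → f l ℕ.< f i) ×
  (f i ≡ 0 ⊎ ∃ λ l → Ascent w i l × f i ≡ suc (f l))

rajcode-rank : ∀ (w : Permutation′ n) i → RankAt w (rajcode w) i
rajcode-rank w i = above , attained
  where
  above : ∀ {i l} → Ascent w i l → rajcode w l ℕ.< rajcode w i
  above {i} {l} i↗l with longest-chain w l
  ... | xs , chain , len = subst (ℕ._< rajcode w i) len (chain-length w (i↗l ∷ chain))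
  attained : rajcode w i ≡ 0 ⊎ ∃ λ l → Ascent w i l × rajcode w i ≡ suc (rajcode w l)
  attained with longest-chain w i
  ... | [] , _ , len = inj₁ (sym len)
  ... | l ∷ xs , i↗l ∷ chain , len = inj₂ (l , i↗l ,
    ℕ.≤-antisym (subst (ℕ._≤ suc (rajcode w l)) len (s≤s (chain-length w chain))) (above i↗l))

-- Induction on the value `m` of `f` instead of positions: along the ascent attaining f(i), `f`
-- drops by one and `g` drops strictly.
rank-unique : ∀ {w : Permutation′ n} {f g : Fin n → ℕ} →
  (∀ i → RankAt w f i) → (∀ i → RankAt w g i) → ∀ i → f i ≡ g i
rank-unique {w = w} f-rank g-rank i =
  ℕ.≤-antisym (go f-rank g-rank _ i refl) (go g-rank f-rank _ i refl)
  where
  go : ∀ {f g} → (∀ i → RankAt w f i) → (∀ i → RankAt w g i) → ∀ m i → f i ≡ m → m ℕ.≤ g i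
  go f-rank g-rank zero    i _    = z≤n
  go f-rank g-rank (suc m) i fi≡ with proj₂ (f-rank i)
  ... | inj₁ fi≡0 = contradiction (trans (sym fi≡0) fi≡) λ ()
  ... | inj₂ (l , i↗l , fi≡1+fl) = ℕ.≤-<-trans
    (go f-rank g-rank m l (ℕ.suc-injective (trans (sym fi≡1+fl) fi≡)))
    (proj₁ (g-rank i) i↗l)

raj-rank : ∀ {w : Permutation′ n} {f : Fin n → ℕ} → (∀ i → RankAt w f i) → raj w ≡ ∑ f
raj-rank {w = w} f-rank = trans (sum-allFin (rajcode w))
  (sum-cong-≗ (rank-unique {w = w} (rajcode-rank w) f-rank))

-- Records

K°? : ∀ (w : Permutation′ n) a k → Dec (K° w a k)
K°? w a k = ascent? w a k ×-dec
  all? (λ l → (a <? l) →-dec ((l <? k) →-dec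
    (((w ⟨$⟩ʳ a) <? (w ⟨$⟩ʳ l)) →-dec ¬? ((w ⟨$⟩ʳ l) <? (w ⟨$⟩ʳ k)))))

IsRecord : Permutation′ n → Fin n → (Fin n → ℕ) → Fin n → Set
IsRecord w a f k = K° w a k × (∀ k′ → K° w a k′ → k′ < k → f k′ ℕ.≤ f k)

isRecord? : ∀ (w : Permutation′ n) a f k → Dec (IsRecord w a f k)
isRecord? w a f k = K°? w a k ×-dec
  all? (λ k′ → K°? w a k′ →-dec ((k′ <? k) →-dec (f k′ ℕ.≤? f k)))

-- `K°` consists of the ascents from `a` that are minimal in position and value jointly. Passing
-- from a non-minimal ascent to one below it terminates, as positions decrease.
K°-below : ∀ (w : Permutation′ n) {a l} → Ascent w a l →
  ∃ λ k → K° w a k × k ≤ l × w ⟨$⟩ʳ k ≤ w ⟨$⟩ʳ l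
K°-below w {a} {l} = go (Fin.<-wellFounded l)
  where
  go : ∀ {l} → Acc _<_ l → Ascent w a l → ∃ λ k → K° w a k × k ≤ l × w ⟨$⟩ʳ k ≤ w ⟨$⟩ʳ l
  go {l} (acc rec) a↗l with any? (λ m → ascent? w a m ×-dec ascent? w m l)
  ... | yes (m , a↗m , m<l , wm<wl) with go (rec m<l) a↗m
  ...   | k , κ , k≤m , wk≤wm = k , κ , ℕ.≤-trans k≤m (ℕ.<⇒≤ m<l) , ℕ.≤-trans wk≤wm (ℕ.<⇒≤ wm<wl)
  go {l} (acc rec) a↗l | no none =
    l , (a↗l , λ m a<m m<l wa<wm wm<wl → none (m , (a<m , wa<wm) , m<l , wm<wl)) , ℕ.≤-refl , ℕ.≤-refl

-- As long as an earlier element of `K°` has a strictly larger value of `f`, move to it. The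
-- strictness kept in the second alternative later separates the last record from the elements after
-- it.
record-below : ∀ (w : Permutation′ n) a f {k} → K° w a k →
  ∃ λ r → IsRecord w a f r × r ≤ k × (r ≡ k ⊎ f k ℕ.< f r)
record-below w a f {k} = go (Fin.<-wellFounded k)
  where
  go : ∀ {k} → Acc _<_ k → K° w a k → ∃ λ r → IsRecord w a f r × r ≤ k × (r ≡ k ⊎ f k ℕ.< f r)
  go {k} (acc rec) κ with any? (λ k′ → K°? w a k′ ×-dec ((k′ <? k) ×-dec (f k ℕ.<? f k′)))
  ... | yes (k′ , κ′ , k′<k , fk<fk′) with go (rec k′<k) κ′
  ...   | r , isRec , r≤k′ , bound = r , isRec , ℕ.≤-trans r≤k′ (ℕ.<⇒≤ k′<k) , inj₂ (raise bound)
    where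
    raise : r ≡ k′ ⊎ f k′ ℕ.< f r → f k ℕ.< f r
    raise (inj₁ refl)   = fk<fk′
    raise (inj₂ fk′<fr) = ℕ.<-trans fk<fk′ fk′<fr
  go {k} (acc rec) κ | no none =
    k , (κ , λ k′ κ′ k′<k → ℕ.≮⇒≥ λ lt → none (k′ , κ′ , k′<k , lt)) , ℕ.≤-refl , inj₁ refl

-- Otherwise `k` would lie in the rectangle of `b`. Hence values fall along `K°` as positions grow.
K°-incomparable : ∀ (w : Permutation′ n) {a k b} → K° w a k → K° w a b → k < b →
  w ⟨$⟩ʳ b < w ⟨$⟩ʳ k
K°-incomparable w ((a<k , wa<wk) , _) (_ , empty) k<b =
  ≮∧≢⇒> (empty _ a<k k<b wa<wk) (<⇒≢ k<b ∘ ⟨$⟩ʳ-injective w)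

-- The swaps of a stair

-- The state of the swaps of a stair: those at positions ≥ B have been made, bs are
-- the ones to come. f is the code of u except at a, where it is the code that the
-- value u(a) will have after the next swap.
record Partial (u : Permutation′ n) (f : Fin n → ℕ) (a : Fin n) (B : ℕ) (bs : List (Fin n)) : Set where
  field
    top        : ∀ {i l} → i < a → i < l → u ⟨$⟩ʳ l < u ⟨$⟩ʳ i
    rank       : ∀ {i} → i ≢ a → RankAt u f i
    beyond     : ∀ {l} → Ascent u a l → B ℕ.≤ toℕ l → f l ℕ.< f a
    bounded    : ∀ {k} → K° u a k → toℕ k ℕ.< B → f k ℕ.≤ f a
    attained   : f a ≡ 0 ⊎ ∃ λ l → Ascent u a l × All (_< l) bs × f a ≡ suc (f l)
    smaller    : ∀ {b i} → b ∈ bs → a < i → i < b → u ⟨$⟩ʳ i < u ⟨$⟩ʳ a → f a ℕ.< f i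
    decreasing : AllPairs _>_ bs
    members    : ∀ k → k ∈ bs ⇔ (toℕ k ℕ.< B × IsRecord u a f k)

-- The head `b` is the rightmost record below `B`. After the swap u(a) rests at `b` with f(a), and
-- u(b) waits at `a` with f(b), so each value keeps its number.
module PartialStep {u : Permutation′ n} {f : Fin n → ℕ} {a b : Fin n} {B : ℕ} {bs : List (Fin n)}
  (inv : Partial u f a B (b ∷ bs)) where
  open Partial inv

  private
    u′ = u · (a , b)
    f′ = f ∘ PC.transpose a b

    isRec : IsRecord u a f b
    isRec = proj₂ (Equivalence.to (members b) (here refl))

    b<B : toℕ b ℕ.< B
    b<B = proj₁ (Equivalence.to (members b) (here refl))

    κ : K° u a b
    κ = proj₁ isRec

    a<b = proj₁ (proj₁ κ)
    ua<ub = proj₂ (proj₁ κ)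
    b≢a = ≢-sym (<⇒≢ a<b)

    u′a : u′ ⟨$⟩ʳ a ≡ u ⟨$⟩ʳ b
    u′a = cong (u ⟨$⟩ʳ_) (transpose-left a b)
    u′b : u′ ⟨$⟩ʳ b ≡ u ⟨$⟩ʳ a
    u′b = cong (u ⟨$⟩ʳ_) (transpose-right a b)
    u′≡ : ∀ {i} → i ≢ a → i ≢ b → u′ ⟨$⟩ʳ i ≡ u ⟨$⟩ʳ i
    u′≡ i≢a i≢b = cong (u ⟨$⟩ʳ_) (transpose-other i≢a i≢b)
    f′a : f′ a ≡ f b
    f′a = cong f (transpose-left a b)
    f′b : f′ b ≡ f a
    f′b = cong f (transpose-right a b)
    f′≡ : ∀ {i} → i ≢ a → i ≢ b → f′ i ≡ f i
    f′≡ i≢a i≢b = cong f (transpose-other i≢a i≢b)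

    between : ∀ {i} → a < i → i < b → i ≢ a × i ≢ b
    between a<i i<b = ≢-sym (<⇒≢ a<i) , <⇒≢ i<b

    after : ∀ {i} → b < i → i ≢ a × i ≢ b
    after b<i = ≢-sym (<⇒≢ (ℕ.<-trans a<b b<i)) , ≢-sym (<⇒≢ b<i)

    below-u : ∀ {i} → a < i → i < b → u ⟨$⟩ʳ i < u ⟨$⟩ʳ b → u ⟨$⟩ʳ i < u ⟨$⟩ʳ a
    below-u a<i i<b ui<ub = ≮∧≢⇒> (λ ua<ui → proj₂ κ _ a<i i<b ua<ui ui<ub)
      (<⇒≢ a<i ∘ ⟨$⟩ʳ-injective u)

    -- Raising the value at `a` to u(b) loses nothing left of `b`, since elements of `K°` there have
    -- values above u(b). Conversely nothing arises, because no position between `a` and `b` has a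
    -- value between u(a) and u(b).
    K°⇒ : ∀ {k} → k < b → K° u a k → K° u′ a k
    K°⇒ {k} k<b κₖ@((a<k , _) , empty) with between a<k k<b
    ... | k≢a , k≢b = (a<k , subst₂ _<_ (sym u′a) (sym (u′≡ k≢a k≢b)) (K°-incomparable u κₖ κ k<b)) ,
      λ l a<l l<k u′a<u′l u′l<u′k → let l≢a , l≢b = between a<l (ℕ.<-trans l<k k<b) in
        empty l a<l l<k
          (ℕ.<-trans ua<ub (subst₂ _<_ u′a (u′≡ l≢a l≢b) u′a<u′l))
          (subst₂ _<_ (u′≡ l≢a l≢b) (u′≡ k≢a k≢b) u′l<u′k)

    K°⇐ : ∀ {k} → k < b → K° u′ a k → K° u a k
    K°⇐ {k} k<b ((a<k , u′a<u′k) , empty) with between a<k k<b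
    ... | k≢a , k≢b = (a<k , ℕ.<-trans ua<ub (subst₂ _<_ u′a (u′≡ k≢a k≢b) u′a<u′k)) ,
      λ l a<l l<k ua<ul ul<uk → let l<b = ℕ.<-trans l<k k<b ; l≢a , l≢b = between a<l l<b in
        empty l a<l l<k
          (subst₂ _<_ (sym u′a) (sym (u′≡ l≢a l≢b))
            (≮∧≢⇒> (proj₂ κ l a<l l<b ua<ul) (l≢b ∘ ⟨$⟩ʳ-injective u)))
          (subst₂ _<_ (sym (u′≡ l≢a l≢b)) (sym (u′≡ k≢a k≢b)) ul<uk)

    -- The new bound is one past `b`, so `b` itself has to be excluded: after the swap it holds the
    -- smaller value u(a).
    K°-<b : ∀ {k} → K° u′ a k → toℕ k ℕ.< suc (toℕ b) → k < b
    K°-<b ((_ , u′a<u′k) , _) (s≤s k≤b) =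
      ≤∧≢⇒< k≤b λ { refl → ℕ.<-asym ua<ub (subst₂ _<_ u′a u′b u′a<u′k) }

    fb≤fa : f b ℕ.≤ f a
    fb≤fa = bounded κ b<B

    -- b is the last record below B, so f b bounds f on K° u a strictly between b and B.
    right-of-b : ∀ {l} → b < l → u ⟨$⟩ʳ a < u ⟨$⟩ʳ l → f l ℕ.< f a
    right-of-b {l} b<l ua<ul with toℕ l ℕ.<? B
    ... | no l≮B = beyond (ℕ.<-trans a<b b<l , ua<ul) (ℕ.≮⇒≥ l≮B)
    ... | yes l<B with K°-below u (ℕ.<-trans a<b b<l , ua<ul)
    ...   | k , κₖ@((a<k , _) , _) , k≤l , uk≤ul = ℕ.<-≤-trans fl<fb fb≤fa
      where
      fl≤fk : f l ℕ.≤ f k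
      fl≤fk with k ≟ l
      ... | yes refl = ℕ.≤-refl
      ... | no k≢l = ℕ.<⇒≤ (proj₁ (rank (≢-sym (<⇒≢ a<k)))
        (≤∧≢⇒< k≤l k≢l , ≤∧≢⇒< uk≤ul (k≢l ∘ ⟨$⟩ʳ-injective u)))
      fk<fb : b < k → f k ℕ.< f b
      fk<fb b<k with record-below u a f κₖ
      ... | r , r-rec , r≤k , r≡k⊎fk<fr with
              Equivalence.from (members r) (ℕ.≤-<-trans (ℕ.≤-trans r≤k k≤l) l<B , r-rec)
      ...   | here refl = [ (λ { refl → contradiction b<k (ℕ.<-irrefl refl) }) , id ]′ r≡k⊎fk<fr
      ...   | there r∈bs with All.lookup (AllPairs.head decreasing) r∈bs | r≡k⊎fk<fr
      ...     | r<b | inj₁ refl  = contradiction b<k (ℕ.<-asym r<b)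
      ...     | r<b | inj₂ fk<fr = ℕ.<-≤-trans fk<fr (proj₂ isRec r (proj₁ r-rec) r<b)
      fl<fb : f l ℕ.< f b
      fl<fb with b <? k
      ... | yes b<k = ℕ.≤-<-trans fl≤fk (fk<fb b<k)
      -- A minimal ascent `k` at or left of `b` has u(b) ≤ u(k) ≤ u(l), so `l` is an ascent from
      -- `b`.
      ... | no b≮k = proj₁ (rank b≢a) (b<l ,
        ≤∧≢⇒< (ℕ.≤-trans (ub≤uk (k ≟ b)) uk≤ul) (<⇒≢ b<l ∘ ⟨$⟩ʳ-injective u))
        where
        ub≤uk : Dec (k ≡ b) → u ⟨$⟩ʳ b ≤ u ⟨$⟩ʳ k
        ub≤uk (yes refl) = ℕ.≤-refl
        ub≤uk (no k≢b)   = ℕ.<⇒≤ (K°-incomparable u κₖ κ (≮∧≢⇒> b≮k (≢-sym k≢b)))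

    top′ : ∀ {i l} → i < a → i < l → u′ ⟨$⟩ʳ l < u′ ⟨$⟩ʳ i
    top′ {i} {l} i<a i<l = subst (u′ ⟨$⟩ʳ l <_) (sym (u′≡ (<⇒≢ i<a) (<⇒≢ (ℕ.<-trans i<a a<b))))
      (go (transpose-view a b l))
      where
      go : TransposeView a b l → u′ ⟨$⟩ʳ l < u ⟨$⟩ʳ i
      go (left refl _)  = subst (_< u ⟨$⟩ʳ i) (sym u′a) (top i<a (ℕ.<-trans i<a a<b))
      go (right refl _) = subst (_< u ⟨$⟩ʳ i) (sym u′b) (top i<a i<a)
      go (other _ _ e)  = subst (_< u ⟨$⟩ʳ i) (cong (u ⟨$⟩ʳ_) (sym e)) (top i<a i<l)

    ascent⇐ : ∀ {i l} → i ≢ a → i ≢ b → l ≢ a → l ≢ b → Ascent u′ i l → Ascent u i l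
    ascent⇐ i≢a i≢b l≢a l≢b (i<l , lt) = i<l , subst₂ _<_ (u′≡ i≢a i≢b) (u′≡ l≢a l≢b) lt

    ascent⇒ : ∀ {i l} → i ≢ a → i ≢ b → l ≢ a → l ≢ b → Ascent u i l → Ascent u′ i l
    ascent⇒ i≢a i≢b l≢a l≢b (i<l , lt) = i<l , subst₂ _<_ (sym (u′≡ i≢a i≢b)) (sym (u′≡ l≢a l≢b)) lt

    -- The ascents from `b` are now the former ascents from `a` that lie right of `b`. `right-of-b`
    -- bounds them, and the witness for f(a) survives because it lies beyond every link to come.
    rank-b : RankAt u′ f′ b
    rank-b = above , [ (λ fa≡0 → inj₁ (trans f′b fa≡0)) , inj₂ ∘ witness ]′ attained
      where
      above : ∀ {l} → Ascent u′ b l → f′ l ℕ.< f′ b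
      above (b<l , lt) with after b<l
      ... | l≢a , l≢b = subst₂ ℕ._<_ (sym (f′≡ l≢a l≢b)) (sym f′b)
        (right-of-b b<l (subst₂ _<_ u′b (u′≡ l≢a l≢b) lt))
      witness : (∃ λ l → Ascent u a l × All (_< l) (b ∷ bs) × f a ≡ suc (f l)) →
        ∃ λ l → Ascent u′ b l × f′ b ≡ suc (f′ l)
      witness (l , (_ , ua<ul) , b<l ∷ _ , fa≡) with after b<l
      ... | l≢a , l≢b = l , (b<l , subst₂ _<_ (sym u′b) (sym (u′≡ l≢a l≢b)) ua<ul) ,
        trans f′b (trans fa≡ (cong suc (sym (f′≡ l≢a l≢b))))

    rank-other : ∀ {i} → i ≢ a → i ≢ b → RankAt u′ f′ i
    rank-other {i} i≢a i≢b = above , [ (λ fi≡0 → inj₁ (trans (f′≡ i≢a i≢b) fi≡0)) , inj₂ ∘ witness ]′ (proj₂ (rank i≢a))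
      where
      above : ∀ {l} → Ascent u′ i l → f′ l ℕ.< f′ i
      above {l} i↗l = subst (f′ l ℕ.<_) (sym (f′≡ i≢a i≢b)) (go (transpose-view a b l) (i <? a))
        where
        go : TransposeView a b l → Dec (i < a) → f′ l ℕ.< f i
        go _              (yes i<a) = contradiction (top′ i<a (proj₁ i↗l)) (ℕ.<-asym (proj₂ i↗l))
        go (left refl _)  (no i≮a)  = contradiction (proj₁ i↗l) i≮a
        go (right refl _) (no i≮a)  = subst (ℕ._< f i) (sym f′b)
          (smaller (here refl) (≮∧≢⇒> i≮a i≢a) (proj₁ i↗l)
            (subst₂ _<_ (u′≡ i≢a i≢b) u′b (proj₂ i↗l)))
        go (other l≢a l≢b _) (no _) = subst (ℕ._< f i) (sym (f′≡ l≢a l≢b))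
          (proj₁ (rank i≢a) (ascent⇐ i≢a i≢b l≢a l≢b i↗l))
      witness : (∃ λ l → Ascent u i l × f i ≡ suc (f l)) → ∃ λ l → Ascent u′ i l × f′ i ≡ suc (f′ l)
      witness (l , i↗l@(i<l , ui<ul) , fi≡) = go (transpose-view a b l) (i <? a)
        where
        go : TransposeView a b l → Dec (i < a) → ∃ λ l → Ascent u′ i l × f′ i ≡ suc (f′ l)
        go _             (yes i<a) = contradiction (top i<a i<l) (ℕ.<-asym ui<ul)
        go (left refl _) (no i≮a)  = contradiction i<l i≮a
        go (other l≢a l≢b _) (no _) = l , ascent⇒ i≢a i≢b l≢a l≢b i↗l ,
          trans (f′≡ i≢a i≢b) (trans fi≡ (cong suc (sym (f′≡ l≢a l≢b))))
        -- The witness position `b` has exchanged u(b) for u(a); it remains a witness by f(i) = 1 +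
        -- f(b) ≤ 1 + f(a) ≤ f(i).
        go (right refl _) (no i≮a) = l ,
          (i<l , subst₂ _<_ (sym (u′≡ i≢a i≢b)) (sym u′b) ui<ua) ,
          trans (f′≡ i≢a i≢b) (ℕ.≤-antisym
            (subst₂ ℕ._≤_ (sym fi≡) (cong suc (sym f′b)) (s≤s fb≤fa))
            (subst (ℕ._< f i) (sym f′b) (smaller (here refl) a<i i<l ui<ua)))
          where
          a<i = ≮∧≢⇒> i≮a i≢a
          ui<ua = below-u a<i i<l ui<ul

    rank′ : ∀ {i} → i ≢ a → RankAt u′ f′ i
    rank′ {i} i≢a with i ≟ b
    ... | yes refl = rank-b
    ... | no i≢b   = rank-other i≢a i≢b

    f′-K° : ∀ {k} → K° u a k → k < b → f′ k ≡ f k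
    f′-K° ((a<k , _) , _) k<b = uncurry f′≡ (between a<k k<b)

    record⇒ : ∀ {k} → k < b → IsRecord u a f k → IsRecord u′ a f′ k
    record⇒ k<b (κₖ , max) = K°⇒ k<b κₖ , λ k′ κ′ k′<k →
      subst₂ ℕ._≤_ (sym (f′-K° (K°⇐ (ℕ.<-trans k′<k k<b) κ′) (ℕ.<-trans k′<k k<b))) (sym (f′-K° κₖ k<b))
        (max k′ (K°⇐ (ℕ.<-trans k′<k k<b) κ′) k′<k)

    record⇐ : ∀ {k} → k < b → IsRecord u′ a f′ k → IsRecord u a f k
    record⇐ k<b (κₖ , max) = K°⇐ k<b κₖ , λ k′ κ′ k′<k →
      subst₂ ℕ._≤_ (f′-K° κ′ (ℕ.<-trans k′<k k<b)) (f′-K° (K°⇐ k<b κₖ) k<b)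
        (max k′ (K°⇒ (ℕ.<-trans k′<k k<b) κ′) k′<k)

  next : Partial u′ f′ a (suc (toℕ b)) bs
  next = record
    { top        = top′
    ; rank       = rank′
    ; beyond     = λ { (a<l , lt) b<l → let l≢a , l≢b = after b<l in
        subst₂ ℕ._<_ (sym (f′≡ l≢a l≢b)) (sym f′a)
          (proj₁ (rank b≢a) (b<l , subst₂ _<_ u′a (u′≡ l≢a l≢b) lt)) }
    ; bounded    = λ κₖ k≤b → let k<b = K°-<b κₖ k≤b ; k≢a , k≢b = between (proj₁ (proj₁ κₖ)) k<b in
        subst₂ ℕ._≤_ (sym (f′≡ k≢a k≢b)) (sym f′a) (proj₂ isRec _ (K°⇐ k<b κₖ) k<b)
    -- The value u(b) brings its own witness, right of `b` and so of all remaining links.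
    ; attained   = [ (λ fb≡0 → inj₁ (trans f′a fb≡0))
        , (λ { (l , (b<l , ub<ul) , fb≡) → let l≢a , l≢b = after b<l in
             inj₂ (l , (ℕ.<-trans a<b b<l , subst₂ _<_ (sym u′a) (sym (u′≡ l≢a l≢b)) ub<ul) ,
               All.map (λ b′<b → ℕ.<-trans b′<b b<l) (AllPairs.head decreasing) ,
               trans f′a (trans fb≡ (cong suc (sym (f′≡ l≢a l≢b))))) })
        ]′ (proj₂ (rank b≢a))
    -- f(b) ≤ f(a) < f(i), because by the empty rectangle a value below u(b) is also below u(a).
    ; smaller    = λ b′∈bs a<i i<b′ lt →
        let i<b = ℕ.<-trans i<b′ (All.lookup (AllPairs.head decreasing) b′∈bs)
            i≢a , i≢b = between a<i i<b
        in subst₂ ℕ._<_ (sym f′a) (sym (f′≡ i≢a i≢b)) (ℕ.≤-<-trans fb≤fa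
             (smaller (here refl) a<i i<b (below-u a<i i<b (subst₂ _<_ (u′≡ i≢a i≢b) u′a lt))))
    ; decreasing = AllPairs.tail decreasing
    ; members    = λ k → mk⇔
        (λ k∈bs → let k<b = All.lookup (AllPairs.head decreasing) k∈bs in
          ℕ.m<n⇒m<1+n k<b , record⇒ k<b (proj₂ (Equivalence.to (members k) (there k∈bs))))
        (λ (k≤b , k-rec) → let k<b = K°-<b (proj₁ k-rec) k≤b in
          not-here k<b (Equivalence.from (members k) (ℕ.<-trans k<b b<B , record⇐ k<b k-rec)))
    }
    where
    not-here : ∀ {k} → k < b → k ∈ b ∷ bs → k ∈ bs
    not-here k<b (here refl)  = contradiction refl (<⇒≢ k<b)
    not-here k<b (there k∈bs) = k∈bs

-- The value that `B` reaches after all swaps; as a fold it reduces in step with `complete`.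
lastEnd : ℕ → List (Fin n) → ℕ
lastEnd B bs = foldl (λ _ b → suc (toℕ b)) B bs

record Completed (u : Permutation′ n) (f : Fin n → ℕ) (a : Fin n) (B : ℕ) (bs : List (Fin n)) : Set where
  field
    covers  : Covers u (map (a ,_) bs)
    code    : Fin n → ℕ
    rank    : ∀ i → RankAt (u ·* map (a ,_) bs) code i
    total   : ∑ code ≡ ∑ f
    fixed   : ∀ {i} → i < a → (u ·* map (a ,_) bs) ⟨$⟩ʳ i ≡ u ⟨$⟩ʳ i
    ascents : ∀ {l} → Ascent (u ·* map (a ,_) bs) a l → lastEnd B bs ℕ.≤ toℕ l

-- Every ascent from `a` lies above a record, so once no record is left below `B`, no ascent is
-- either. Then `beyond` covers all ascents and the recursion holds at `a` too. The swaps only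
-- permute `f`, which preserves its sum.
complete : ∀ {u : Permutation′ n} {f a B} bs → Partial u f a B bs → Completed u f a B bs
complete {u = u} {f} {a} {B} [] inv = record
  { covers  = []
  ; code    = f
  ; rank    = rank-all
  ; total   = refl
  ; fixed   = λ _ → refl
  ; ascents = ascents
  }
  where
  open Partial inv
  ascents : ∀ {l} → Ascent u a l → B ℕ.≤ toℕ l
  ascents {l} a↗l = ℕ.≮⇒≥ λ l<B → let k , κ , k≤l , _ = K°-below u a↗l
                                      r , r-rec , r≤k , _ = record-below u a f κ
    in none (Equivalence.from (members r) (ℕ.≤-<-trans (ℕ.≤-trans r≤k k≤l) l<B , r-rec))
    where
    none : ∀ {r} → ¬ r ∈ []
    none ()
  rank-all : ∀ i → RankAt u f i
  rank-all i with i ≟ a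
  ... | no i≢a   = rank i≢a
  ... | yes refl = (λ a↗l → beyond a↗l (ascents a↗l)) ,
    [ inj₁ , (λ (l , a↗l , _ , fa≡) → inj₂ (l , a↗l , fa≡)) ]′ attained
complete {u = u} {f} {a} {B} (b ∷ bs) inv = record
  { covers  = K°⇒⋖ (proj₁ isRec) ∷ covers
  ; code    = code
  ; rank    = rank
  ; total   = trans total (sym (sum-permute f (transpose a b)))
  ; fixed   = λ i<a → trans (fixed i<a) (cong (u ⟨$⟩ʳ_)
      (transpose-other (<⇒≢ i<a) (<⇒≢ (ℕ.<-trans i<a (proj₁ (proj₁ (proj₁ isRec)))))))
  ; ascents = ascents
  }
  where
  isRec = proj₂ (Equivalence.to (Partial.members inv b) (here refl))
  open Completed (complete bs (PartialStep.next inv))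

-- Layers are records

least : {P : Pred (Fin n) 0ℓ} → Decidable P → ∀ {k} → P k → ∃ (IsMin P)
least {P = P} P? {k} = go (Fin.<-wellFounded k)
  where
  go : ∀ {k} → Acc _<_ k → P k → ∃ (IsMin P)
  go {k} (acc rec) pk with any? (λ j → (j <? k) ×-dec P? j)
  ... | yes (j , j<k , pj) = go (rec j<k) pj
  ... | no none = k , pk , λ pj → ℕ.≮⇒≥ λ j<k → none (_ , j<k , pj)

IsMin-unique : {P : Pred (Fin n) 0ℓ} → ∀ {l m} → IsMin P l → IsMin P m → l ≡ m
IsMin-unique (pl , l≤) (pm , m≤) = toℕ-injective (ℕ.≤-antisym (l≤ pm) (m≤ pl))

argMax? : (f : Fin n → ℕ) {S : Pred (Fin n) 0ℓ} → Decidable S → Decidable (ArgMax f S)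
argMax? f S? k = S? k ×-dec map′ (λ max {l} → max l) (λ max l → max {l})
  (all? λ l → S? l →-dec (f l ℕ.≤? f k))

argMax-exists : (f : Fin n → ℕ) {S : Pred (Fin n) 0ℓ} → Decidable S → ∀ {k} → S k → ∃ (ArgMax f S)
argMax-exists {n} f {S} S? {k} sk =
  argmax f k candidates , argmax-all f sk (All.tabulate (proj₂ ∘ ∈-filter⁻ S? {xs = allFin n})) ,
  λ {l} sl → All.lookup (f[xs]≤f[argmax] {f = f} k candidates) (∈-filter⁺ S? (∈-allFin l) sl)
  where candidates = filter S? (allFin n)

-- A record at or right of the least maximizer is at least as large, hence a maximizer itself; a
-- record left of it is a candidate for the next layer.
record-maximal-or-below : ∀ (w : Permutation′ n) a f {S : Pred (Fin n) 0ℓ} →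
  Decidable S → (∀ {j} → S j → K° w a j) → ∀ {k} → S k → IsRecord w a f k →
  ArgMax f S k ⊎ ∃ λ m → IsMin (ArgMax f S) m × k < m
record-maximal-or-below w a f S? S⊆K° {k} sk (_ , rec) with
  least (argMax? f S?) (proj₂ (argMax-exists f S? sk))
... | m , isMin@((sm , max) , _) with k <? m
...   | yes k<m = inj₂ (m , isMin , k<m)
...   | no k≮m  = inj₁ (sk , λ sl → ℕ.≤-trans (max sl) (fm≤fk (m ≟ k)))
  where
  fm≤fk : Dec (m ≡ k) → f m ℕ.≤ f k
  fm≤fk (yes refl) = ℕ.≤-refl
  fm≤fk (no m≢k)   = rec m (S⊆K° sm) (≮∧≢⇒> k≮m (≢-sym m≢k))

module _ (w : Permutation′ n) (a : Fin n) where
  K⇒K° : ∀ {k} → K w a k → K° w a k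
  K⇒K° (a<k , w⋖) = ⋖⇒K° a<k w⋖

  K°⇒K : ∀ {k} → K° w a k → K w a k
  K°⇒K κ = proj₁ (proj₁ κ) , K°⇒⋖ κ

  -- The set over which a layer maximizes is closed under moving left within K, so a maximizer is
  -- not exceeded by any earlier element.
  layer⇒record : ∀ p {k} → Layer w a p k → IsRecord w a (rajcode w) k
  layer⇒record zero    (κ , max) = K⇒K° κ , λ _ κ′ _ → max (K°⇒K κ′)
  layer⇒record (suc p) ((κ , m , isMin , k<m) , max) =
    K⇒K° κ , λ _ κ′ k′<k → max (K°⇒K κ′ , m , isMin , ℕ.<-trans k′<k k<m)

  -- `k` remains a candidate while it lies left of the current layer's minimum, and these minima
  -- decrease strictly, so some layer takes it.
  record⇒layer : ∀ {k} → IsRecord w a (rajcode w) k → ∃ λ p → Layer w a p k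
  record⇒layer {k} k-rec =
    [ (λ layer → 0 , layer)
    , (λ (m , isMin , k<m) → go 0 (Fin.<-wellFounded m) isMin k<m)
    ]′ (record-maximal-or-below w a (rajcode w)
         (λ j → map′ K°⇒K K⇒K° (K°? w a j)) K⇒K° (K°⇒K (proj₁ k-rec)) k-rec)
    where
    go : ∀ p {m} → Acc _<_ m → IsMin (Layer w a p) m → k < m → ∃ λ p → Layer w a p k
    go p {m} (acc rec) isMin k<m =
      [ (λ layer → suc p , layer)
      , (λ (m′ , isMin′ , k<m′) → go (suc p) (rec (below-m (proj₁ (proj₁ isMin′)))) isMin′ k<m′)
      ]′ (record-maximal-or-below w a (rajcode w) {S = S}
           -- Uniqueness of the minimum turns the existential in `S` into the decidable bound
           -- `j < m`.
           (λ j → map′ (λ (κ , j<m) → K°⇒K κ , m , isMin , j<m)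
                       (λ s → K⇒K° (proj₁ s) , below-m s)
                       (K°? w a j ×-dec (j <? m)))
           (λ (κ , _) → K⇒K° κ) (K°⇒K (proj₁ k-rec) , m , isMin , k<m) k-rec)
      where
      S : Pred (Fin n) 0ℓ
      S j = K w a j × ∃ λ m → IsMin (Layer w a p) m × j < m
      below-m : ∀ {j} → S j → j < m
      below-m {j} (_ , m′ , isMin′ , j<m′) =
        subst (j <_) (IsMin-unique {P = Layer w a p} isMin′ isMin) j<m′

  layer⇔record : ∀ k → (∃ λ p → Layer w a p k) ⇔ IsRecord w a (rajcode w) k
  layer⇔record k = mk⇔ (λ (p , layer) → layer⇒record p layer) record⇒layer

-- Existence and uniqueness of stairs

opposite-antitone : ∀ {i j : Fin n} → i < j → opposite j < opposite i
opposite-antitone {i = i} {j} i<j rewrite opposite-prop i | opposite-prop j =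
  ℕ.∸-monoʳ-< (s≤s i<j) (toℕ<n j)

stair-exists : ∀ (w : Permutation′ n) {a} → IsMin (λ k → w ⟨$⟩ʳ k ≢ opposite k) a → ∃ (IsStair w a)
stair-exists {n} w {a} isMin = filter R? descending , record
  { first      = isMin
  ; decreasing = Linked.AllPairs⇒Linked (AllPairs.filter⁺ R? (AllPairs.tabulate⁺-< {f = opposite} opposite-antitone))
  ; members    = λ k → mk⇔
      (λ k∈ → record⇒layer w a (proj₂ (∈-filter⁻ R? {xs = descending} k∈)))
      (λ (p , layer) → ∈-filter⁺ R?
        (subst (_∈ descending) (opposite-involutive k) (∈-tabulate⁺ (opposite k)))
        (layer⇒record w a p layer))
  }
  where
  R? = isRecord? w a (rajcode w)
  descending = tabulate (opposite {n})

decreasing-unique : ∀ {xs ys : List (Fin n)} → AllPairs _>_ xs → AllPairs _>_ ys →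
  (∀ k → k ∈ xs ⇔ k ∈ ys) → xs ≡ ys
decreasing-unique []       []       _  = refl
decreasing-unique []       (_ ∷ _)  eq with () ← Equivalence.from (eq _) (here refl)
decreasing-unique (_ ∷ _)  []       eq with () ← Equivalence.to (eq _) (here refl)
decreasing-unique {xs = x ∷ xs} {y ∷ ys} (x>xs ∷ xs↓) (y>ys ∷ ys↓) eq with
  toℕ-injective (ℕ.≤-antisym (bound y>ys (Equivalence.to (eq x) (here refl)))
                             (bound x>xs (Equivalence.from (eq y) (here refl))))
  where
  bound : ∀ {z k : Fin _} {zs} → All (_< z) zs → k ∈ z ∷ zs → k ≤ z
  bound _   (here refl) = ℕ.≤-refl
  bound z>  (there k∈)  = ℕ.<⇒≤ (All.lookup z> k∈)
... | refl = cong (x ∷_) (decreasing-unique xs↓ ys↓ λ k → mk⇔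
  (λ k∈ → drop (All.lookup x>xs k∈) (Equivalence.to (eq k) (there k∈)))
  (λ k∈ → drop (All.lookup y>ys k∈) (Equivalence.from (eq k) (there k∈))))
  where
  drop : ∀ {k : Fin _} {zs} → k < x → k ∈ x ∷ zs → k ∈ zs
  drop k<x (here refl) = contradiction refl (<⇒≢ k<x)
  drop _   (there k∈)  = k∈

>-decreasing : ∀ {xs : List (Fin n)} → Linked _>_ xs → AllPairs _>_ xs
>-decreasing = Linked.Linked⇒AllPairs λ y<x z<y → ℕ.<-trans z<y y<x

stair-unique : ∀ {w : Permutation′ n} {a a′ bs bs′} → IsStair w a bs → IsStair w a′ bs′ →
  a ≡ a′ × bs ≡ bs′
stair-unique st st′ with IsMin-unique (IsStair.first st) (IsStair.first st′)
... | refl = refl , decreasing-unique (>-decreasing (decreasing st)) (>-decreasing (decreasing st′))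
  λ k → ⇔-sym (members st′ k) ⇔-∘ members st k
  where open IsStair

staircase-unique : ∀ {w : Permutation′ n} {C D} → IsStaircaseChain w C → IsStaircaseChain w D → C ≡ D
staircase-unique (done _)         (done _)         = refl
staircase-unique (done w≈)        (step w≉ _ _)    = contradiction w≈ w≉
staircase-unique (step w≉ _ _)    (done w≈)        = contradiction w≈ w≉
staircase-unique (step {a} {bs} _ st chain) (step _ st′ chain′) with stair-unique st st′
... | refl , refl = cong (map (a ,_) bs ++_) (staircase-unique chain chain′)

-- A stair lowers raj by one

module Stair {w : Permutation′ n} {a : Fin n} {bs : List (Fin n)}
  (first : IsMin (λ k → w ⟨$⟩ʳ k ≢ opposite k) a) (decreasing : AllPairs _>_ bs)
  (r : Fin n → ℕ) (r-rank : ∀ i → RankAt w r i) (mem⇔ : ∀ k → k ∈ bs ⇔ IsRecord w a r k) where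

  private
    f = updateAt r a pred

    moved : w ⟨$⟩ʳ a ≢ opposite a
    moved = proj₁ first

    before : ∀ {i} → i < a → w ⟨$⟩ʳ i ≡ opposite i
    before {i} i<a = decidable-stable (w ⟨$⟩ʳ i ≟ opposite i) λ w≢ → ℕ.<⇒≱ i<a (proj₂ first w≢)

    -- Before `a` the permutation agrees with the longest one, so a value above w(i) already sits to
    -- the left of `i`.
    top : ∀ {i l} → i < a → i < l → w ⟨$⟩ʳ l < w ⟨$⟩ʳ i
    top {i} {l} i<a i<l = ≮∧≢⇒> wi≮wl (<⇒≢ i<l ∘ ⟨$⟩ʳ-injective w)
      where
      wi≮wl : ¬ w ⟨$⟩ʳ i < w ⟨$⟩ʳ l
      wi≮wl lt = <⇒≢ (ℕ.<-trans j<i i<l) (⟨$⟩ʳ-injective w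
          (trans (before (ℕ.<-trans j<i i<a)) (opposite-involutive (w ⟨$⟩ʳ l))))
        where
        j<i : opposite (w ⟨$⟩ʳ l) < i
        j<i = subst (opposite (w ⟨$⟩ʳ l) <_) (trans (cong opposite (before i<a)) (opposite-involutive i))
          (opposite-antitone lt)

    -- The witness is the position of the value `opposite a`: the larger values fill the positions
    -- before `a`, so this one comes later and exceeds w(a).
    ascent : ∃ (Ascent w a)
    ascent = k , a<k , subst (w ⟨$⟩ʳ a <_) (sym wk≡) wa<
      where
      k = w ⟨$⟩ˡ opposite a
      wk≡ : w ⟨$⟩ʳ k ≡ opposite a
      wk≡ = inverseʳ w
      a<k : a < k
      a<k = ≮∧≢⇒> (λ k<a → <⇒≢ (opposite-antitone k<a) (sym (trans (sym (before k<a)) wk≡)))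
        (λ k≡a → moved (trans (cong (w ⟨$⟩ʳ_) (sym k≡a)) wk≡))
      wa< : w ⟨$⟩ʳ a < opposite a
      wa< = ≮∧≢⇒> (λ lt → let j = opposite (w ⟨$⟩ʳ a)
                              j<a = subst (j <_) (opposite-involutive a) (opposite-antitone lt)
          in <⇒≢ j<a (⟨$⟩ʳ-injective w (trans (before j<a) (opposite-involutive (w ⟨$⟩ʳ a)))))
        (≢-sym moved)

    f≡r : ∀ {i} → i ≢ a → f i ≡ r i
    f≡r {i} i≢a = updateAt-minimal i a r i≢a

    f≡r-K° : ∀ {k} → K° w a k → f k ≡ r k
    f≡r-K° ((a<k , _) , _) = f≡r (≢-sym (<⇒≢ a<k))

    fa≡ : f a ≡ pred (r a)
    fa≡ = updateAt-updates a r

    r-decreases : ∀ {i l} → Ascent w i l → r l ℕ.< r i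
    r-decreases {i} = proj₁ (r-rank i)

    ra≡ : r a ≡ suc (f a)
    ra≡ = trans (sym (ℕ.suc-pred (r a) {{ℕ.≢-nonZero (ℕ.m<n⇒n≢0 (r-decreases (proj₂ ascent)))}}))
      (cong suc (sym fa≡))

    r≤fa : ∀ {l} → Ascent w a l → r l ℕ.≤ f a
    r≤fa {l} a↗l = ℕ.≤-pred (subst (r l ℕ.<_) ra≡ (r-decreases a↗l))

    -- From an ascent attaining r(a), descend to a minimal ascent and then to a record; the code
    -- never drops on the way, and f(a) bounds it.
    top-record : ∃ λ k → IsRecord w a r k × r k ≡ f a
    top-record with proj₂ (r-rank a)
    ... | inj₁ ra≡0 = contradiction (trans (sym ra≡0) ra≡) λ ()
    ... | inj₂ (l , a↗l , ra≡1+rl) with K°-below w a↗l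
    ...   | k , κ , k≤l , wk≤wl with record-below w a r κ
    ...     | m , m-rec , _ , bound = m , m-rec , ℕ.≤-antisym (r≤fa (proj₁ (proj₁ m-rec)))
      (ℕ.≤-trans (ℕ.≤-reflexive (ℕ.suc-injective (trans (sym ra≡) ra≡1+rl)))
        (ℕ.≤-trans (rl≤rk (k ≟ l)) (rk≤rm bound)))
      where
      rl≤rk : Dec (k ≡ l) → r l ℕ.≤ r k
      rl≤rk (yes refl) = ℕ.≤-refl
      rl≤rk (no k≢l)   = ℕ.<⇒≤ (r-decreases
        (≤∧≢⇒< k≤l k≢l , ≤∧≢⇒< wk≤wl (k≢l ∘ ⟨$⟩ʳ-injective w)))
      rk≤rm : m ≡ k ⊎ r k ℕ.< r m → r k ℕ.≤ r m
      rk≤rm (inj₁ refl) = ℕ.≤-refl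
      rk≤rm (inj₂ lt)   = ℕ.<⇒≤ lt

    -- Codes rise weakly along the records from left to right, so the last one, which heads `bs`,
    -- attains the bound reached by `top-record`.
    head-spec : ∃ λ b → K° w a b × All (_≤ b) bs × r b ≡ f a
    head-spec = go bs decreasing mem⇔
      where
      go : ∀ cs → AllPairs _>_ cs → (∀ k → k ∈ cs ⇔ IsRecord w a r k) →
        ∃ λ b → K° w a b × All (_≤ b) cs × r b ≡ f a
      go [] _ mem with top-record
      ... | k , k-rec , _ with () ← Equivalence.from (mem k) k-rec
      go (b ∷ cs) (b> ∷ _) mem with top-record | Equivalence.to (mem b) (here refl)
      ... | k , k-rec , rk≡ | κ , b-rec = b , κ , ℕ.≤-refl ∷ All.map ℕ.<⇒≤ b> ,
        ℕ.≤-antisym (r≤fa (proj₁ κ)) (subst (ℕ._≤ r b) rk≡ (rk≤rb (Equivalence.from (mem k) k-rec)))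
        where
        rk≤rb : k ∈ b ∷ cs → r k ℕ.≤ r b
        rk≤rb (here refl)  = ℕ.≤-refl
        rk≤rb (there k∈cs) = b-rec k (proj₁ k-rec) (All.lookup b> k∈cs)

    largest = proj₁ head-spec
    κ-largest : K° w a largest
    κ-largest = proj₁ (proj₂ head-spec)
    ≤largest : All (_≤ largest) bs
    ≤largest = proj₁ (proj₂ (proj₂ head-spec))
    r-largest : r largest ≡ f a
    r-largest = proj₂ (proj₂ (proj₂ head-spec))

  start : Partial w f a n bs
  start = record
    { top        = top
    ; rank       = rank
    ; beyond     = λ {l} _ n≤l → contradiction (toℕ<n l) (ℕ.≤⇒≯ n≤l)
    ; bounded    = λ κ _ → subst (ℕ._≤ f a) (sym (f≡r-K° κ)) (r≤fa (proj₁ κ))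
    ; attained   = attained
    -- `i` ascends to the largest record, whose code is f(a).
    ; smaller    = λ {b} {i} b∈ a<i i<b wi<wa → subst₂ ℕ._<_ r-largest (sym (f≡r (≢-sym (<⇒≢ a<i))))
        (r-decreases (ℕ.<-≤-trans i<b (All.lookup ≤largest b∈) ,
                      ℕ.<-trans wi<wa (proj₂ (proj₁ κ-largest))))
    ; decreasing = decreasing
    ; members    = λ k → mk⇔
        (λ k∈ → toℕ<n k , to-f (Equivalence.to (mem⇔ k) k∈))
        (λ (_ , k-rec) → Equivalence.from (mem⇔ k) (from-f k-rec))
    }
    where
    to-f : ∀ {k} → IsRecord w a r k → IsRecord w a f k
    to-f (κ , max) = κ , λ k′ κ′ k′<k → subst₂ ℕ._≤_ (sym (f≡r-K° κ′)) (sym (f≡r-K° κ)) (max k′ κ′ k′<k)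
    from-f : ∀ {k} → IsRecord w a f k → IsRecord w a r k
    from-f (κ , max) = κ , λ k′ κ′ k′<k → subst₂ ℕ._≤_ (f≡r-K° κ′) (f≡r-K° κ) (max k′ κ′ k′<k)
    -- No ascent ends at `a`, so lowering the number there leaves the recursion at every other
    -- position intact.
    a-unseen : ∀ {i l} → Ascent w i l → l ≢ a
    a-unseen (i<l , lt) refl = ℕ.<-asym lt (top i<l i<l)
    rank : ∀ {i} → i ≢ a → RankAt w f i
    rank {i} i≢a = (λ i↗l → subst₂ ℕ._<_ (sym (f≡r (a-unseen i↗l))) (sym (f≡r i≢a)) (r-decreases i↗l)) ,
      [ (λ ri≡0 → inj₁ (trans (f≡r i≢a) ri≡0))
      , (λ (l , i↗l , ri≡) → inj₂ (l , i↗l ,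
          trans (f≡r i≢a) (trans ri≡ (cong suc (sym (f≡r (a-unseen i↗l))))))) ]′
      (proj₂ (r-rank i))
    attained : f a ≡ 0 ⊎ ∃ λ l → Ascent w a l × All (_< l) bs × f a ≡ suc (f l)
    attained = [ (λ r≡0 → inj₁ (trans (sym r-largest) r≡0))
      , (λ (l , (b<l , wb<wl) , r≡) → inj₂ (l ,
          (ℕ.<-trans (proj₁ (proj₁ κ-largest)) b<l , ℕ.<-trans (proj₂ (proj₁ κ-largest)) wb<wl) ,
          All.map (λ b≤ → ℕ.≤-<-trans b≤ b<l) ≤largest ,
          trans (sym r-largest) (trans r≡ (cong suc (sym (f≡r (a-unseen (b<l , wb<wl)))))))) ]′
      (proj₂ (r-rank largest))

  private module Done = Completed (complete bs start)
  open Done public using (covers; ascents)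

  raj-drops : raj w ≡ suc (raj (w ·* map (a ,_) bs))
  raj-drops = trans (raj-rank {w = w} r-rank) (trans ∑r≡
    (cong suc (sym (trans (raj-rank {w = w ·* map (a ,_) bs} Done.rank) Done.total))))
    where
    ∑r≡ : ∑ r ≡ suc (∑ f)
    ∑r≡ = ℕ.≤-antisym
      (∑-mono-except a 0 1 (λ j j≢a → ℕ.≤-reflexive (sym (f≡r j≢a))) (ℕ.≤-reflexive ra≡))
      (∑-mono-except a 1 0 (λ j j≢a → ℕ.≤-reflexive (f≡r j≢a)) (ℕ.≤-reflexive (sym ra≡)))

  still-fixed : ∀ {i} → i < a → (w ·* map (a ,_) bs) ⟨$⟩ʳ i ≡ opposite i
  still-fixed i<a = trans (Done.fixed i<a) (before i<a)

  nonempty : bs ≢ []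
  nonempty refl with () ← Equivalence.from (mem⇔ _) (proj₁ (proj₂ top-record))

  ascends : ∀ {b} → b ∈ bs → Ascent w a b
  ascends b∈ = proj₁ (proj₁ (Equivalence.to (mem⇔ _) b∈))

module IsStairProperties {n} {w : Permutation′ n} {a : Fin n} {bs : List (Fin n)} (st : IsStair w a bs) =
  Stair {w = w} {a} {bs} (IsStair.first st) (>-decreasing (IsStair.decreasing st)) (rajcode w) (rajcode-rank w)
    (λ k → layer⇔record w a k ⇔-∘ IsStair.members st k)

-- Minimal markings

AllPairs-resp-⊆ : ∀ {A : Set} {R : A → A → Set} {xs ys} → xs ⊆ ys → AllPairs R ys → AllPairs R xs
AllPairs-resp-⊆ []         []         = []
AllPairs-resp-⊆ (_ ∷ʳ τ)   (_ ∷ prs)  = AllPairs-resp-⊆ τ prs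
AllPairs-resp-⊆ (refl ∷ τ) (pr ∷ prs) = Sublist.All-resp-⊆ τ pr ∷ AllPairs-resp-⊆ τ prs

laterMarkings : Link n → List (Link n) → List (Link n)
laterMarkings c C = map proj₂ (filter (λ p → proj₁ p <ₗₑₓ? proj₂ p) (zip (c ∷ C) C))

map-proj₂-zip-∷ : ∀ {A : Set} (x : A) xs → map proj₂ (zip (x ∷ xs) xs) ≡ xs
map-proj₂-zip-∷ x []       = refl
map-proj₂-zip-∷ x (y ∷ xs) = cong (y ∷_) (map-proj₂-zip-∷ y xs)

minimalMarkings-⊆ : ∀ (C : List (Link n)) → minimalMarkings C ⊆ C
minimalMarkings-⊆ []      = []
minimalMarkings-⊆ (c ∷ C) = refl ∷ subst (laterMarkings c C ⊆_) (map-proj₂-zip-∷ c C)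
  (Sublist.map⁺ proj₂ (Sublist.filter-⊆ (λ p → proj₁ p <ₗₑₓ? proj₂ p) (zip (c ∷ C) C)))

deduplicate-unique : ∀ {A : Set} (_≟′_ : ∀ (x y : A) → Dec (x ≡ y)) {xs} → Unique xs →
  deduplicate _≟′_ xs ≡ xs
deduplicate-unique _≟′_ []           = refl
deduplicate-unique _≟′_ {x ∷ xs} (x∉ ∷ u) rewrite deduplicate-unique _≟′_ u =
  cong (x ∷_) (filter-all (¬? ∘ (x ≟′_)) x∉)

-- Along a climbing chain the value in position a only grows, and a value that a
-- has given up stays where it was put until a later position is processed.
link-absent : ∀ {w : Permutation′ n} {C a j} → Covers w C → All (uncurry _<_) C →
  AllPairs (λ c d → proj₁ c ≤ proj₁ d) C → All (λ c → a ≤ proj₁ c) C →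
  a < j → w ⟨$⟩ʳ j < w ⟨$⟩ʳ a → (a , j) ∉ C
link-absent {w = w} {(i , k) ∷ C} {a} {j} (w⋖ ∷ covers) (i<k ∷ links) (i≤ ∷ sorted) (a≤i ∷ a≤)
  a<j wj<wa = go (a ≟ i)
  where
  wi<wk = proj₂ (proj₁ (⋖⇒K° i<k w⋖))
  go : Dec (a ≡ i) → (a , j) ∉ (i , k) ∷ C
  go (no a≢i)   (here refl) = a≢i refl
  go (no a≢i)   (there c∈)  = ℕ.<⇒≱ (≤∧≢⇒< a≤i a≢i) (All.lookup i≤ c∈)
  go (yes refl) (here refl) = ℕ.<-asym wj<wa wi<wk
  go (yes refl) (there c∈)  = link-absent covers links sorted a≤ a<j
    (subst₂ _<_ (sym (cong (w ⟨$⟩ʳ_) (transpose-other (≢-sym (<⇒≢ a<j)) j≢k)))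
                (sym (cong (w ⟨$⟩ʳ_) (transpose-left a k))) (ℕ.<-trans wj<wa wi<wk)) c∈
    where
    j≢k : j ≢ k
    j≢k refl = ℕ.<-asym wj<wa wi<wk

-- Right after a link (a, b) the value at `b` is below the value at `a`, and `link-absent` then
-- keeps (a, b) out of the rest.
chain-unique : ∀ {w : Permutation′ n} {C} → Covers w C → All (uncurry _<_) C →
  AllPairs (λ c d → proj₁ c ≤ proj₁ d) C → Unique C
chain-unique []       _             _             = []
chain-unique {w = w} {(a , b) ∷ C} (w⋖ ∷ covers) (a<b ∷ links) (a≤ ∷ sorted) =
  All.tabulate (λ d∈ c≡d → link-absent covers links sorted a≤ a<b swapped (subst (_∈ C) (sym c≡d) d∈))
  ∷ chain-unique covers links sorted
  where
  swapped : (w · (a , b)) ⟨$⟩ʳ b < (w · (a , b)) ⟨$⟩ʳ a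
  swapped = subst₂ _<_ (sym (cong (w ⟨$⟩ʳ_) (transpose-right a b)))
    (sym (cong (w ⟨$⟩ʳ_) (transpose-left a b))) (proj₂ (proj₁ (⋖⇒K° a<b w⋖)))

#M-climbing : ∀ {w : Permutation′ n} {C} → IsClimbingChain w C → #M C ≡ length (minimalMarkings C)
#M-climbing {C = C} climbing = cong length (deduplicate-unique (≡-dec _≟_ _≟_)
  (AllPairs-resp-⊆ (minimalMarkings-⊆ C)
    (chain-unique covers links (Linked.Linked⇒AllPairs ℕ.≤-trans sorted))))
  where open IsClimbingChain climbing

-- The hypothesis makes the first link of `C` lexicographically larger than the last link of the
-- stair, so it is marked there just as it is at the head of `C`.
laterMarkings-stair : ∀ (a b : Fin n) bs {C : List (Link n)} → AllPairs _>_ (b ∷ bs) →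
  (∀ {c D} → C ≡ c ∷ D → a < proj₁ c ⊎ (a ≡ proj₁ c × lastEnd (suc (toℕ b)) bs ℕ.≤ toℕ (proj₂ c))) →
  length (laterMarkings (a , b) (map (a ,_) bs ++ C)) ≡ length (minimalMarkings C)
laterMarkings-stair a b [] {[]}    _ _  = refl
laterMarkings-stair a b [] {c ∷ C} _ hd = cong (length ∘ map proj₂)
  (filter-accept (λ p → proj₁ p <ₗₑₓ? proj₂ p) {xs = zip (c ∷ C) C} (hd refl))
laterMarkings-stair a b (b′ ∷ bs) {C} ((b′<b ∷ _) ∷ bs↓) hd = trans
  (cong (length ∘ map proj₂) (filter-reject (λ p → proj₁ p <ₗₑₓ? proj₂ p) {xs = zip ((a , b′) ∷ rest) rest} unmarked))
  (laterMarkings-stair a b′ bs bs↓ hd)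
  where
  rest = map (a ,_) bs ++ C
  unmarked : ¬ (a , b) <ₗₑₓ (a , b′)
  unmarked (inj₁ a<a)        = ℕ.<-irrefl refl a<a
  unmarked (inj₂ (_ , b<b′)) = ℕ.<-asym b<b′ b′<b

-- The staircase chain

-- The equation stands in for an index because `map (a ,_) bs ++ C` does not unify with a cons until
-- `bs` is known to be nonempty.
staircase-head : ∀ {w : Permutation′ n} {C a b D} → IsStaircaseChain w C → C ≡ (a , b) ∷ D →
  w ⟨$⟩ʳ a ≢ opposite a × Ascent w a b
staircase-head (step {bs = []}    _ st _) _    = ⊥-elim (IsStairProperties.nonempty st refl)
staircase-head (step {bs = _ ∷ _} _ st _) refl =
  proj₁ (IsStair.first st) , IsStairProperties.ascends st (here refl)

covers-++ : ∀ {w : Permutation′ n} {C D} → Covers w C → Covers (w ·* C) D → Covers w (C ++ D)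
covers-++ []             covers′ = covers′
covers-++ (w⋖ ∷ covers)  covers′ = w⋖ ∷ covers-++ covers covers′

sorted-++ : ∀ (a : Fin n) bs {C : List (Link n)} → (∀ {c D} → C ≡ c ∷ D → a ≤ proj₁ c) →
  Linked (λ c d → proj₁ c ≤ proj₁ d) C → Linked (λ c d → proj₁ c ≤ proj₁ d) (map (a ,_) bs ++ C)
sorted-++ a []            hd sorted = sorted
sorted-++ a (b ∷ [])      {[]}    hd sorted = [-]
sorted-++ a (b ∷ [])      {c ∷ C} hd sorted = hd refl ∷ sorted
sorted-++ a (b ∷ b′ ∷ bs) hd sorted = ℕ.≤-refl ∷ sorted-++ a (b′ ∷ bs) hd sorted

raj-reverse : ∀ {w : Permutation′ n} → w ≈ reverse → raj w ≡ 0
raj-reverse {n} {w} w≈ = trans (raj-rank {w = w} {f = λ _ → 0} λ i → no-ascent , inj₁ refl)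
  (sum-replicate-zero n)
  where
  no-ascent : ∀ {i l} → Ascent w i l → 0 ℕ.< 0
  no-ascent {i} {l} (i<l , lt) =
    contradiction (opposite-antitone i<l) (ℕ.<-asym (subst₂ _<_ (w≈ i) (w≈ l) lt))

prepend-stair : ∀ {w : Permutation′ n} {a : Fin n} {bs : List (Fin n)} {C : List (Link n)} (let w′ = w ·* map (a ,_) bs) → IsStair w a bs →
  IsStaircaseChain w′ C → IsClimbingChain w′ C × length (minimalMarkings C) ≡ raj w′ →
  IsClimbingChain w (map (a ,_) bs ++ C) × length (minimalMarkings (map (a ,_) bs ++ C)) ≡ raj w
prepend-stair {bs = []} st _ _ = ⊥-elim (IsStairProperties.nonempty st refl)
prepend-stair {n} {w} {a} {bs@(b ∷ bs′)} {C} st chain (climbing , count) = record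
    { links  = All.++⁺ (All.map⁺ (All.tabulate (proj₁ ∘ ascends))) links
    ; sorted = sorted-++ a bs head≥a sorted
    ; ends   = λ i → trans (cong (_⟨$⟩ʳ i) (foldl-++ _·_ w (map (a ,_) bs) C)) (ends i)
    ; covers = covers-++ (IsStairProperties.covers st) covers
    } ,
    trans (cong suc (laterMarkings-stair a b bs′ (>-decreasing (IsStair.decreasing st)) next-link))
      (trans (cong suc count) (sym raj-drops))
  where
  open IsClimbingChain climbing
  open IsStairProperties st using (ascends; ascents; still-fixed; raj-drops)

  head≥a : ∀ {c D} → C ≡ c ∷ D → a ≤ proj₁ c
  head≥a eq = ℕ.≮⇒≥ (proj₁ (staircase-head chain eq) ∘ still-fixed)

  next-link : ∀ {c D} → C ≡ c ∷ D →
    a < proj₁ c ⊎ (a ≡ proj₁ c × lastEnd n bs ℕ.≤ toℕ (proj₂ c))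
  next-link {i , j} eq = go (a ≟ i) (proj₂ (staircase-head chain eq))
    where
    go : Dec (a ≡ i) → Ascent (w ·* map (a ,_) bs) i j → a < i ⊎ (a ≡ i × lastEnd n bs ℕ.≤ toℕ j)
    -- When the next stair starts at the same `a`, its first link is an ascent that this stair has
    -- left over.
    go (yes refl) a↗j = inj₂ (refl , ascents a↗j)
    go (no a≢i)   _   = inj₁ (≤∧≢⇒< (head≥a eq) a≢i)

staircase-climbing : ∀ {w : Permutation′ n} {C} → IsStaircaseChain w C →
  IsClimbingChain w C × length (minimalMarkings C) ≡ raj w
staircase-climbing {w = w} (done w≈) =
  record { links = [] ; sorted = [] ; ends = w≈ ; covers = [] } , sym (raj-reverse {w = w} w≈)
staircase-climbing (step _ st chain) = prepend-stair st chain (staircase-climbing chain)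

least-moved : ∀ (w : Permutation′ n) → ¬ w ≈ reverse → ∃ (IsMin λ k → w ⟨$⟩ʳ k ≢ opposite k)
least-moved w w≉ with any? (λ k → ¬? (w ⟨$⟩ʳ k ≟ opposite k))
... | yes (k , w≢) = least (λ k → ¬? (w ⟨$⟩ʳ k ≟ opposite k)) w≢
... | no none = contradiction
  (λ k → decidable-stable (w ⟨$⟩ʳ k ≟ opposite k) λ w≢ → none (k , w≢)) w≉

staircase-exists : ∀ (w : Permutation′ n) → ∃ (IsStaircaseChain w)
staircase-exists {n} w = go (raj w) w refl
  where
  go : ∀ m (w : Permutation′ n) → raj w ≡ m → ∃ (IsStaircaseChain w)

  extend : ∀ m (w : Permutation′ n) a bs → ¬ w ≈ reverse → IsStair w a bs →
    m ≡ suc (raj (w ·* map (a ,_) bs)) → ∃ (IsStaircaseChain w)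
  extend (suc m) w a bs w≉ st m≡ = map (a ,_) bs ++ proj₁ rest , step w≉ st (proj₂ rest)
    where
    rest : ∃ (IsStaircaseChain (w ·* map (a ,_) bs))
    rest = go m (w ·* map (a ,_) bs) (ℕ.suc-injective (sym m≡))

  go m w raj≡ with all? (λ k → w ⟨$⟩ʳ k ≟ opposite k)
  ... | yes w≈ = [] , done w≈
  ... | no w≉  = extend m w a bs w≉ st (trans (sym raj≡) (IsStairProperties.raj-drops st))
    where
    a = proj₁ (least-moved w w≉)
    bs = proj₁ (stair-exists w (proj₂ (least-moved w w≉)))
    st : IsStair w a bs
    st = proj₂ (stair-exists w (proj₂ (least-moved w w≉)))

theorem11p12 : ∀ (n : ℕ) (w : Permutation′ n) →
    ∃! _≡_ (IsStaircaseChain w) ×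
    (∀ C → IsStaircaseChain w C → IsHeavyClimbingChain w C)
theorem11p12 n w =
  (let C , chain = staircase-exists w in C , chain , staircase-unique chain) ,
  λ C chain → let climbing , count = staircase-climbing chain in
    record { climbing = climbing ; heavy = trans (#M-climbing climbing) count }
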